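{- Let $m \in \{5,19,35,41,51,65,75,101,129\}$ and let $C$ be an extremal binary doubly even self-dual $[24m,12m,4m+4]$ code. Then the support design $D$ of the minimum weight $4m+4$ of $C$ is not a $7$-design.
   Context: A binary linear code is self-dual if $C=C^\perp$ with respect to the standard inner product, and doubly even if all weights are divisible by $4$. An extremal binary doubly even self-dual $[24m,12m,4m+4]$ code has length $24m$, dimension $12m$ and minimum weight $4m+4$. The support of a codeword $c$ is the set of indices of its nonzero coordinates. The support design of $C$ for weight $w$ has the $24m$ coordinate indices as points and the supports of all codewords of weight $w$ as blocks. A $t$-design is a pair $(X,\mathcal{B})$ of a point set and a collection of $k$-subsets (blocks) such that every $t$-subset of $X$ lies in the same number $\lambda$ of blocks. -}

module Defs where

open import Level using (0ℓ)
open import Data.Bool using (Bool; true; false; _xor_; _∧_)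
open import Data.Nat using (ℕ; zero; suc; _+_; _*_; _^_; _≤_)
open import Data.Nat.Divisibility using (_∣_)
open import Data.Vec using (Vec; []; _∷_; replicate; zipWith; foldr; toList)
open import Data.List using (List; []; _∷_; map; _++_; length; filter)
open import Data.Fin.Subset using (Subset; _⊆_; ∣_∣)
open import Data.Fin.Subset.Properties using (_⊆?_)
open import Data.Product using (Σ; ∃; _×_; _,_)
open import Relation.Binary.PropositionalEquality using (_≡_)
open import Relation.Nullary using (¬_; Dec)
open import Relation.Unary using (Pred; Decidable)

-- Binary words of length n (vectors over GF(2), Bool with xor as addition).
Word : ℕ → Set
Word n = Vec Bool n

Code : ℕ → Set₁
Code n = Pred (Word n) 0ℓ

zeroWord : ∀ {n} → Word n
zeroWord = replicate _ false

_⊕_ : ∀ {n} → Word n → Word n → Word n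
_⊕_ = zipWith _xor_

⟨_,_⟩ : ∀ {n} → Word n → Word n → Bool
⟨ x , y ⟩ = foldr _ _xor_ false (zipWith _∧_ x y)

wt : ∀ {n} → Word n → ℕ
wt x = ∣ x ∣

-- Support of a word: the set of indices of nonzero coordinates
-- (as a Subset n, which is a characteristic vector, so it is x itself).
support : ∀ {n} → Word n → Subset n
support x = x

allWords : ∀ n → List (Word n)
allWords zero = [] ∷ []
allWords (suc n) = map (false ∷_) (allWords n) ++ map (true ∷_) (allWords n)

IsLinear : ∀ {n} → Code n → Set
IsLinear C = C zeroWord × (∀ x y → C x → C y → C (x ⊕ y))

Dual : ∀ {n} → Code n → Code n
Dual C x = ∀ c → C c → ⟨ x , c ⟩ ≡ false

IsSelfDual : ∀ {n} → Code n → Set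
IsSelfDual C = ∀ x → (C x → Dual C x) × (Dual C x → C x)

IsDoublyEven : ∀ {n} → Code n → Set
IsDoublyEven C = ∀ c → C c → 4 ∣ wt c

size : ∀ {n} (C : Code n) → Decidable C → ℕ
size {n} C C? = length (filter C? (allWords n))

-- Dimension k means |C| = 2^k (for a linear code).
HasDimension : ∀ {n} (C : Code n) → Decidable C → ℕ → Set
HasDimension C C? k = size C C? ≡ 2 ^ k

HasMinWeight : ∀ {n} → Code n → ℕ → Set
HasMinWeight C d = (∀ c → C c → ¬ (c ≡ zeroWord) → d ≤ wt c)
                 × (∃ λ c → C c × ¬ (c ≡ zeroWord) × wt c ≡ d)

IsExtremalDESD : (m : ℕ) (C : Code (24 * m)) → Decidable C → Set
IsExtremalDESD m C C? =
  IsLinear C × IsSelfDual C × IsDoublyEven C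
  × HasDimension C C? (12 * m) × HasMinWeight C (4 * m + 4)

-- Block designs on point set Fin n, blocks given as a list (multiset) of subsets.
record Design (n : ℕ) : Set where
  constructor design
  field
    blocks : List (Subset n)

countContaining : ∀ {n} → Design n → Subset n → ℕ
countContaining D T = length (filter (T ⊆?_) (Design.blocks D))

IsTDesign : ∀ {n} → ℕ → Design n → Set
IsTDesign {n} t D =
  (∃ λ k → ∀ B → B Data.List.Membership.Propositional.∈ Design.blocks D → ∣ B ∣ ≡ k)
  × (∃ λ lam → ∀ (T : Subset n) → ∣ T ∣ ≡ t → countContaining D T ≡ lam)
  where import Data.List.Membership.Propositional

supportDesign : ∀ {n} (C : Code n) → Decidable C → ℕ → Design n
supportDesign {n} C C? w =
  design (map support (filter (λ c → C? c Relation.Nullary.×-dec (wt c Data.Nat.≟ w)) (allWords n)))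
  where import Data.Nat

{-# OPTIONS --safe #-}
module Submission where

-- Let k = 4m+4, v = 24m, and let b be the number of codewords of weight k.  A self-dual code of
-- minimum weight k is an orthogonal array of strength k-1, so the mean weight moments of degree
-- below k are those of the whole space; applied to F(w) = ∏ (t - w) over the 4m other possible
-- weights t, this determines b.  If the words of weight k formed a 7-design, then b would determine
-- λ₇, and the number of blocks through any s ≤ 7 points.  Fix a block T, a point p ∈ T and a
-- point q ∉ T.  For a block B through p and q the size y of B ∩ (T ∖ {p}) is odd, as ∣B ∩ T∣ is
-- even, so 384 = 2⁴ · 4! divides (y+1)(y-1)(y-3)(y-5).  The sum of these products over the blocks
-- through p and q involves only the numbers of blocks through 2, …, 6 points; computing it shows
-- that it is not divisible by 384 for the listed m.

open import Defs
open import Data.Nat using (ℕ; _*_; _+_)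
open import Data.List using (List; _∷_; [])
open import Data.List.Membership.Propositional using (_∈_)
open import Relation.Nullary using (¬_)
open import Relation.Unary using (Decidable)

open import Data.Bool using (Bool; true; false; not; _xor_)
import Data.Bool.Properties as Bool
open import Data.Fin using (Fin; zero; suc)
open import Data.Fin.Subset using (Subset; ∣_∣; _∩_; ∁; ⊤)
import Data.Fin.Properties as Fin
import Data.Fin.Subset.Properties as Sub
open import Data.Integer as ℤ using (ℤ; +_; 0ℤ; 1ℤ)
import Data.Integer.Properties as ℤ
open import Data.Integer.Divisibility.Signed as ∣ using (divides) renaming (_∣_ to _∣ᶻ_)
open import Data.Integer.Tactic.RingSolver using (solve-∀)
import Data.Nat.Tactic.RingSolver as ℕSolver
open import Data.List using (_++_; map; foldr; length; filter; upTo)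
open import Data.List.Membership.Propositional.Properties using (∈-filter⁻; ∈-map⁻; ∈-map⁺; ∈-upTo⁺; ∈-upTo⁻)
open import Data.List.Properties using (length-map; length-upTo)
open import Data.List.Relation.Unary.Any using (here; there)
open import Data.Nat as ℕ using (zero; suc; _∸_; _^_; _≤_; _<_; z≤n; s≤s; _!)
import Data.Nat.Divisibility as ℕ∣
import Data.Nat.Properties as ℕ
open import Data.Product using (∃; _×_; _,_; proj₁; proj₂)
open import Data.Sum using (_⊎_; inj₁; inj₂)
open import Data.Vec using ([]; _∷_; lookup; _[_]≔_)
import Data.Vec.Properties as Vec
open import Function using (_∘_)
open import Relation.Binary.PropositionalEquality
open import Relation.Nullary using (Dec; yes; no; does; _×-dec_; contradiction)
open import Relation.Nullary.Decidable using (from-no)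

private variable
  A B : Set
  n : ℕ

-- Finite integer sums, indicators, and sums over all binary words.

Σ : List A → (A → ℤ) → ℤ
Σ []       f = 0ℤ
Σ (x ∷ xs) f = f x ℤ.+ Σ xs f

Σ-cong-∈ : (xs : List A) {f g : A → ℤ} → (∀ x → x ∈ xs → f x ≡ g x) → Σ xs f ≡ Σ xs g
Σ-cong-∈ []       eq = refl
Σ-cong-∈ (x ∷ xs) eq = cong₂ ℤ._+_ (eq x (here refl)) (Σ-cong-∈ xs (λ y y∈ → eq y (there y∈)))

Σ-cong : (xs : List A) {f g : A → ℤ} → (∀ x → f x ≡ g x) → Σ xs f ≡ Σ xs g
Σ-cong xs eq = Σ-cong-∈ xs (λ x _ → eq x)

Σ-zero : (xs : List A) {f : A → ℤ} → (∀ x → f x ≡ 0ℤ) → Σ xs f ≡ 0ℤ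
Σ-zero []       eq = refl
Σ-zero (x ∷ xs) eq rewrite eq x | Σ-zero xs eq = refl

Σ-+ : (xs : List A) (f g : A → ℤ) → Σ xs (λ x → f x ℤ.+ g x) ≡ Σ xs f ℤ.+ Σ xs g
Σ-+ []       f g = refl
Σ-+ (x ∷ xs) f g = trans (cong (λ s → f x ℤ.+ g x ℤ.+ s) (Σ-+ xs f g)) (interchange (f x) (g x) (Σ xs f) (Σ xs g))
  where
  interchange : ∀ a b c d → a ℤ.+ b ℤ.+ (c ℤ.+ d) ≡ a ℤ.+ c ℤ.+ (b ℤ.+ d)
  interchange = solve-∀

Σ-*ˡ : (xs : List A) (c : ℤ) (f : A → ℤ) → Σ xs (λ x → c ℤ.* f x) ≡ c ℤ.* Σ xs f
Σ-*ˡ []       c f = sym (ℤ.*-zeroʳ c)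
Σ-*ˡ (x ∷ xs) c f = trans (cong (λ s → c ℤ.* f x ℤ.+ s) (Σ-*ˡ xs c f)) (sym (ℤ.*-distribˡ-+ c _ _))

Σ-*ʳ : (xs : List A) (c : ℤ) (f : A → ℤ) → Σ xs (λ x → f x ℤ.* c) ≡ Σ xs f ℤ.* c
Σ-*ʳ xs c f = trans (Σ-cong xs (λ x → ℤ.*-comm (f x) c)) (trans (Σ-*ˡ xs c f) (ℤ.*-comm c _))

Σ-swap : (xs : List A) (ys : List B) (f : A → B → ℤ) →
  Σ xs (λ x → Σ ys (f x)) ≡ Σ ys (λ y → Σ xs (λ x → f x y))
Σ-swap []       ys f = sym (Σ-zero ys (λ _ → refl))
Σ-swap (x ∷ xs) ys f =
  trans (cong (λ s → Σ ys (f x) ℤ.+ s) (Σ-swap xs ys f)) (sym (Σ-+ ys (f x) _))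

Σ-++ : (xs ys : List A) (f : A → ℤ) → Σ (xs ++ ys) f ≡ Σ xs f ℤ.+ Σ ys f
Σ-++ []       ys f = sym (ℤ.+-identityˡ _)
Σ-++ (x ∷ xs) ys f = trans (cong (λ s → f x ℤ.+ s) (Σ-++ xs ys f)) (sym (ℤ.+-assoc (f x) _ _))

Σ-map : (h : B → A) (xs : List B) (f : A → ℤ) → Σ (map h xs) f ≡ Σ xs (f ∘ h)
Σ-map h []       f = refl
Σ-map h (x ∷ xs) f = cong (λ s → f (h x) ℤ.+ s) (Σ-map h xs f)

Σ-const : (xs : List A) (c : ℤ) → Σ xs (λ _ → c) ≡ + length xs ℤ.* c
Σ-const []       c = sym (ℤ.*-zeroˡ c)
Σ-const (x ∷ xs) c = trans (cong (λ s → c ℤ.+ s) (Σ-const xs c)) (sym (ℤ.suc-* (+ length xs) c))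

Σ-∣ : (d : ℤ) (xs : List A) {f : A → ℤ} → (∀ x → x ∈ xs → d ∣ᶻ f x) → d ∣ᶻ Σ xs f
Σ-∣ d []       div = divides 0ℤ refl
Σ-∣ d (x ∷ xs) div = ∣.∣m∣n⇒∣m+n (div x (here refl)) (Σ-∣ d xs (λ y y∈ → div y (there y∈)))

ι : Bool → ℤ
ι false = 0ℤ
ι true  = 1ℤ

⟦_⟧ : {P : Set} → Dec P → ℤ
⟦ P? ⟧ = ι (does P?)

Σ-filter : {P : A → Set} (P? : Decidable P) (xs : List A) (f : A → ℤ) →
  Σ (filter P? xs) f ≡ Σ xs (λ x → ⟦ P? x ⟧ ℤ.* f x)
Σ-filter P? []       f = refl
Σ-filter P? (x ∷ xs) f with does (P? x)
... | true  = cong₂ ℤ._+_ (sym (ℤ.*-identityˡ (f x))) (Σ-filter P? xs f)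
... | false = trans (Σ-filter P? xs f)
  (sym (ℤ.+-identityˡ _))

length-filter : {P : A → Set} (P? : Decidable P) (xs : List A) →
  + length (filter P? xs) ≡ Σ xs (λ x → ⟦ P? x ⟧)
length-filter P? []       = refl
length-filter P? (x ∷ xs) with does (P? x)
... | true  = cong (λ s → 1ℤ ℤ.+ s) (length-filter P? xs)
... | false = trans (length-filter P? xs) (sym (ℤ.+-identityˡ _))

Σ-words : (f : Word (suc n) → ℤ) →
  Σ (allWords (suc n)) f ≡ Σ (allWords n) (λ x → f (false ∷ x)) ℤ.+ Σ (allWords n) (λ x → f (true ∷ x))
Σ-words {n} f = trans (Σ-++ (map (false ∷_) (allWords n)) _ f)
  (cong₂ ℤ._+_ (Σ-map (false ∷_) (allWords n) f) (Σ-map (true ∷_) (allWords n) f))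

-- Adding `e` permutes the words: a zero of `e` keeps the two halves of the list in place, a one
-- interchanges them.
Σ-translate : (e : Word n) (f : Word n → ℤ) → Σ (allWords n) f ≡ Σ (allWords n) (λ x → f (x ⊕ e))
Σ-translate []          f = refl
Σ-translate (false ∷ e) f = trans (Σ-words f) (trans
  (cong₂ ℤ._+_ (Σ-translate e _) (Σ-translate e _)) (sym (Σ-words (λ x → f (x ⊕ (false ∷ e))))))
Σ-translate {suc n} (true ∷ e) f = trans (Σ-words f) (trans (ℤ.+-comm (Σ (allWords n) (f ∘ (false ∷_))) _) (trans
  (cong₂ ℤ._+_ (Σ-translate e (f ∘ (true ∷_))) (Σ-translate e (f ∘ (false ∷_)))) (sym (Σ-words (λ x → f (x ⊕ (true ∷ e)))))))

Σ-zeroWord : (f : Word n → ℤ) → (∀ x → ¬ x ≡ zeroWord → f x ≡ 0ℤ) → Σ (allWords n) f ≡ f zeroWord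
Σ-zeroWord {zero}  f vanish = ℤ.+-identityʳ _
Σ-zeroWord {suc n} f vanish = trans (Σ-words f) (trans
  (cong₂ ℤ._+_ (Σ-zeroWord (f ∘ (false ∷_)) (λ x x≢0 → vanish _ (x≢0 ∘ Vec.∷-injectiveʳ)))
               (Σ-zero (allWords n) (λ x → vanish (true ∷ x) λ ())))
  (ℤ.+-identityʳ _))

-- Characters and the strength of a self-dual code as an orthogonal array

sgn : Bool → ℤ
sgn false = 1ℤ
sgn true  = ℤ.- 1ℤ

sgn-xor : ∀ a b → sgn (a xor b) ≡ sgn a ℤ.* sgn b
sgn-xor false false = refl
sgn-xor false true  = refl
sgn-xor true  false = refl
sgn-xor true  true  = refl

χ : Word n → Word n → ℤ
χ y x = sgn ⟨ y , x ⟩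

⟨⟩-⊕ : (y x e : Word n) → ⟨ y , x ⊕ e ⟩ ≡ ⟨ y , x ⟩ xor ⟨ y , e ⟩
⟨⟩-⊕ []          []      []      = refl
⟨⟩-⊕ (false ∷ y) (b ∷ x) (c ∷ e) = ⟨⟩-⊕ y x e
⟨⟩-⊕ (true ∷ y)  (b ∷ x) (c ∷ e) = trans (cong ((b xor c) xor_) (⟨⟩-⊕ y x e)) (interchange b c _ _)
  where
  interchange : ∀ b c p q → (b xor c) xor (p xor q) ≡ (b xor p) xor (c xor q)
  interchange false false p q = refl
  interchange false true  p q = Bool.not-distribʳ-xor p q
  interchange true  false p q = Bool.not-distribˡ-xor p q
  interchange true  true  false q = sym (Bool.not-involutive q)
  interchange true  true  true  q = refl

⟨⟩-zeroˡ : (x : Word n) → ⟨ zeroWord , x ⟩ ≡ false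
⟨⟩-zeroˡ []      = refl
⟨⟩-zeroˡ (b ∷ x) = ⟨⟩-zeroˡ x

χ-⊕ : (y x e : Word n) → χ y (x ⊕ e) ≡ χ y x ℤ.* χ y e
χ-⊕ y x e = trans (cong sgn (⟨⟩-⊕ y x e)) (sgn-xor ⟨ y , x ⟩ ⟨ y , e ⟩)

⊕-cancelʳ : (x e : Word n) → (x ⊕ e) ⊕ e ≡ x
⊕-cancelʳ []      []      = refl
⊕-cancelʳ (b ∷ x) (c ∷ e) = cong₂ _∷_ (cancel b c) (⊕-cancelʳ x e)
  where
  cancel : ∀ b c → (b xor c) xor c ≡ b
  cancel false false = refl
  cancel false true  = refl
  cancel true  false = refl
  cancel true  true  = refl

-- The indicator of `S ⊆ B` as a product of bits over the points of `S`. In this form a new point of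
-- `S` contributes one factor, and the product expands into characters.
incl : Subset n → Subset n → ℤ
incl []          []      = 1ℤ
incl (false ∷ S) (b ∷ B) = incl S B
incl (true ∷ S)  (b ∷ B) = ι b ℤ.* incl S B

⟦⊆?⟧ : (S B : Subset n) → ⟦ S Sub.⊆? B ⟧ ≡ incl S B
⟦⊆?⟧ []          []          = refl
⟦⊆?⟧ (false ∷ S) (b ∷ B)     = ⟦⊆?⟧ S B
⟦⊆?⟧ (true ∷ S)  (false ∷ B) = sym (ℤ.*-zeroˡ (incl S B))
⟦⊆?⟧ (true ∷ S)  (true ∷ B)  = trans (⟦⊆?⟧ S B) (sym (ℤ.*-identityˡ _))

-- The coefficient of χ y in 2^∣ J ∣ incl J = ∏ (1 - χ of the unit word at i), over i ∈ J.
coeff : Word n → Subset n → ℤ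
coeff []          []      = 1ℤ
coeff (false ∷ y) (j ∷ J) = coeff y J
coeff (true ∷ y)  (j ∷ J) = ℤ.- (ι j ℤ.* coeff y J)

-- Each factor satisfies `2 ι b = 1 - sgn b`. Multiplying out over the points of `J` leaves the
-- characters `χ y` of the words `y` supported in `J`, with sign (-1) to the weight of `y`.
incl-expand : (J x : Word n) →
  + (2 ^ ∣ J ∣) ℤ.* incl J x ≡ Σ (allWords n) (λ y → coeff y J ℤ.* χ y x)
incl-expand [] [] = refl
incl-expand {suc n} (j ∷ J) (b ∷ x) = sym (begin
  Σ (allWords (suc n)) (λ y → coeff y (j ∷ J) ℤ.* χ y (b ∷ x))
    ≡⟨ Σ-words {n} _ ⟩
  E ℤ.+ Σ (allWords n) (λ y → ℤ.- (ι j ℤ.* coeff y J) ℤ.* sgn (b xor ⟨ y , x ⟩))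
    ≡⟨ cong (λ s → E ℤ.+ s) (trans (Σ-cong (allWords n) term) (Σ-*ˡ (allWords n) (ℤ.- (ι j ℤ.* sgn b)) _)) ⟩
  E ℤ.+ ℤ.- (ι j ℤ.* sgn b) ℤ.* E
    ≡⟨ cong (λ s → s ℤ.+ ℤ.- (ι j ℤ.* sgn b) ℤ.* s) (sym (incl-expand J x)) ⟩
  F ℤ.+ ℤ.- (ι j ℤ.* sgn b) ℤ.* F
    ≡⟨ last j b ⟩
  + (2 ^ ∣ j ∷ J ∣) ℤ.* incl (j ∷ J) (b ∷ x) ∎)
  where
  open ≡-Reasoning
  E = Σ (allWords n) (λ y → coeff y J ℤ.* χ y x)
  F = + (2 ^ ∣ J ∣) ℤ.* incl J x
  rearrange : ∀ i c s t → ℤ.- (i ℤ.* c) ℤ.* (s ℤ.* t) ≡ ℤ.- (i ℤ.* s) ℤ.* (c ℤ.* t)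
  rearrange = solve-∀
  term : ∀ y → ℤ.- (ι j ℤ.* coeff y J) ℤ.* sgn (b xor ⟨ y , x ⟩) ≡
               ℤ.- (ι j ℤ.* sgn b) ℤ.* (coeff y J ℤ.* χ y x)
  term y = trans (cong (λ s → ℤ.- (ι j ℤ.* coeff y J) ℤ.* s) (sgn-xor b ⟨ y , x ⟩))
                 (rearrange (ι j) (coeff y J) (sgn b) (χ y x))
  outside : ∀ f → f ℤ.+ 0ℤ ℤ.* f ≡ f
  outside = solve-∀
  absent : ∀ p i → p ℤ.* i ℤ.+ ℤ.- 1ℤ ℤ.* (p ℤ.* i) ≡ (+ 2 ℤ.* p) ℤ.* (0ℤ ℤ.* i)
  absent = solve-∀
  present : ∀ p i → p ℤ.* i ℤ.+ 1ℤ ℤ.* (p ℤ.* i) ≡ (+ 2 ℤ.* p) ℤ.* (1ℤ ℤ.* i)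
  present = solve-∀
  double : ∀ i → + (2 ^ suc ∣ J ∣) ℤ.* i ≡ (+ 2 ℤ.* + (2 ^ ∣ J ∣)) ℤ.* i
  double i = cong (ℤ._* i) (ℤ.pos-* 2 (2 ^ ∣ J ∣))
  last : ∀ j b → F ℤ.+ ℤ.- (ι j ℤ.* sgn b) ℤ.* F ≡ + (2 ^ ∣ j ∷ J ∣) ℤ.* incl (j ∷ J) (b ∷ x)
  last false false = outside F
  last false true  = outside F
  last true  false = trans (absent (+ (2 ^ ∣ J ∣)) (incl J x)) (sym (double (0ℤ ℤ.* incl J x)))
  last true  true  = trans (present (+ (2 ^ ∣ J ∣)) (incl J x)) (sym (double (1ℤ ℤ.* incl J x)))

coeff-zeroWord : (J : Subset n) → coeff zeroWord J ≡ 1ℤ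
coeff-zeroWord []      = refl
coeff-zeroWord (j ∷ J) = coeff-zeroWord J

-- A word with more ones than `J` has a one outside `J`, and that coordinate contributes a zero
-- factor.
coeff-large : (y J : Word n) → ∣ J ∣ < ∣ y ∣ → coeff y J ≡ 0ℤ
coeff-large (false ∷ y) (false ∷ J) J<y       = coeff-large y J J<y
coeff-large (false ∷ y) (true ∷ J)  J<y       = coeff-large y J (ℕ.<-trans (ℕ.n<1+n _) J<y)
coeff-large (true ∷ y)  (false ∷ J) J<y       = cong ℤ.-_ (ℤ.*-zeroˡ (coeff y J))
coeff-large (true ∷ y)  (true ∷ J)  (s≤s J<y) = cong (λ s → ℤ.- (1ℤ ℤ.* s)) (coeff-large y J J<y)

does-cong : {P Q : Set} (P? : Dec P) (Q? : Dec Q) → (P → Q) → (Q → P) → does P? ≡ does Q?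
does-cong (yes p) (yes q) f g = refl
does-cong (yes p) (no ¬q) f g = contradiction (f p) ¬q
does-cong (no ¬p) (yes q) f g = contradiction (g q) ¬p
does-cong (no ¬p) (no ¬q) f g = refl

module SelfDual (C : Code n) (C? : Decidable C) (lin : IsLinear C) (sd : IsSelfDual C) where

  -- Translation by a codeword `e` permutes the code and multiplies the sum by `χ y e`. A nonzero
  -- sum therefore excludes `χ y e = -1` for every codeword `e`, so `y` lies in the dual, which is
  -- `C`.
  charSum : ∀ y → ¬ C y → Σ (allWords n) (λ x → ⟦ C? x ⟧ ℤ.* χ y x) ≡ 0ℤ
  charSum y ¬Cy with Σ (allWords n) (λ x → ⟦ C? x ⟧ ℤ.* χ y x) ℤ.≟ 0ℤ
  ... | yes S≡0 = S≡0
  ... | no  S≢0 = contradiction (proj₂ (sd y) dual) ¬Cy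
    where
    S = Σ (allWords n) (λ x → ⟦ C? x ⟧ ℤ.* χ y x)
    scaled : ∀ e → C e → S ≡ S ℤ.* χ y e
    scaled e Ce = trans (Σ-translate e _) (trans (Σ-cong (allWords n) term) (Σ-*ʳ (allWords n) (χ y e) _))
      where
      term : ∀ x → ⟦ C? (x ⊕ e) ⟧ ℤ.* χ y (x ⊕ e) ≡ ⟦ C? x ⟧ ℤ.* χ y x ℤ.* χ y e
      term x = trans (cong₂ ℤ._*_
        (cong ι (does-cong (C? (x ⊕ e)) (C? x)
          (λ Cxe → subst C (⊕-cancelʳ x e) (proj₂ lin _ e Cxe Ce)) (λ Cx → proj₂ lin x e Cx Ce)))
        (χ-⊕ y x e)) (sym (ℤ.*-assoc ⟦ C? x ⟧ (χ y x) (χ y e)))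
    self-negative : ∀ s → s ≡ s ℤ.* ℤ.- 1ℤ → s ≡ 0ℤ
    self-negative (+ zero)       eq = refl
    self-negative (+ suc k)      ()
    self-negative (ℤ.-[1+ k ])   ()
    dual : Dual C y
    dual c Cc with ⟨ y , c ⟩ in eq
    ... | false = refl
    ... | true  = contradiction (self-negative S (trans (scaled c Cc) (cong (λ b → S ℤ.* sgn b) eq))) S≢0

  -- After expansion into characters, words `y` heavier than `J` have coefficient zero. The nonzero
  -- words that are not heavier have weight below `d`, so they lie outside `C` and their character
  -- sums vanish. Only `y = 0` remains, and it contributes the size of the code.
  strength : (d : ℕ) → (∀ c → C c → ¬ c ≡ zeroWord → d ≤ wt c) → ∀ J → ∣ J ∣ < d →
    + (2 ^ ∣ J ∣) ℤ.* Σ (filter C? (allWords n)) (incl J) ≡ + size C C?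
  strength d min J J<d = begin
    + (2 ^ ∣ J ∣) ℤ.* Σ (filter C? (allWords n)) (incl J)
      ≡⟨ Σ-*ˡ (filter C? (allWords n)) (+ (2 ^ ∣ J ∣)) (incl J) ⟨
    Σ (filter C? (allWords n)) (λ x → + (2 ^ ∣ J ∣) ℤ.* incl J x)
      ≡⟨ Σ-filter C? (allWords n) _ ⟩
    Σ (allWords n) (λ x → ⟦ C? x ⟧ ℤ.* (+ (2 ^ ∣ J ∣) ℤ.* incl J x))
      ≡⟨ Σ-cong (allWords n) (λ x → trans (cong (λ s → ⟦ C? x ⟧ ℤ.* s) (incl-expand J x))
           (sym (Σ-*ˡ (allWords n) ⟦ C? x ⟧ _))) ⟩
    Σ (allWords n) (λ x → Σ (allWords n) (λ y → ⟦ C? x ⟧ ℤ.* (coeff y J ℤ.* χ y x)))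
      ≡⟨ Σ-swap (allWords n) (allWords n) _ ⟩
    Σ (allWords n) (λ y → Σ (allWords n) (λ x → ⟦ C? x ⟧ ℤ.* (coeff y J ℤ.* χ y x)))
      ≡⟨ Σ-cong (allWords n) (λ y → trans (Σ-cong (allWords n) (λ x → rearrange ⟦ C? x ⟧ (coeff y J) (χ y x)))
           (Σ-*ˡ (allWords n) (coeff y J) _)) ⟩
    Σ (allWords n) (λ y → coeff y J ℤ.* Σ (allWords n) (λ x → ⟦ C? x ⟧ ℤ.* χ y x))
      ≡⟨ Σ-zeroWord {n} _ vanish ⟩
    coeff zeroWord J ℤ.* Σ (allWords n) (λ x → ⟦ C? x ⟧ ℤ.* χ zeroWord x)
      ≡⟨ trans (cong (λ c → c ℤ.* Σ (allWords n) (λ x → ⟦ C? x ⟧ ℤ.* χ zeroWord x)) (coeff-zeroWord J))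
           (ℤ.*-identityˡ _) ⟩
    Σ (allWords n) (λ x → ⟦ C? x ⟧ ℤ.* χ zeroWord x)
      ≡⟨ Σ-cong (allWords n) (λ x → trans (cong (λ b → ⟦ C? x ⟧ ℤ.* sgn b) (⟨⟩-zeroˡ x)) (ℤ.*-identityʳ ⟦ C? x ⟧)) ⟩
    Σ (allWords n) (λ x → ⟦ C? x ⟧)
      ≡⟨ length-filter C? (allWords n) ⟨
    + size C C? ∎
    where
    open ≡-Reasoning
    rearrange : ∀ i c t → i ℤ.* (c ℤ.* t) ≡ c ℤ.* (i ℤ.* t)
    rearrange = solve-∀
    vanish : ∀ y → ¬ y ≡ zeroWord → coeff y J ℤ.* Σ (allWords n) (λ x → ⟦ C? x ⟧ ℤ.* χ y x) ≡ 0ℤ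
    vanish y y≢0 with ∣ y ∣ ℕ.≤? ∣ J ∣
    ... | yes y≤J = trans (cong (λ s → coeff y J ℤ.* s) (charSum y ¬Cy)) (ℤ.*-zeroʳ (coeff y J))
      where
      ¬Cy : ¬ C y
      ¬Cy Cy = ℕ.<-irrefl refl (ℕ.<-≤-trans (ℕ.≤-<-trans y≤J J<d) (min y Cy y≢0))
    ... | no  y≰J = trans (cong (λ c → c ℤ.* T) (coeff-large y J (ℕ.≰⇒> y≰J))) (ℤ.*-zeroˡ T)
      where T = Σ (allWords n) (λ x → ⟦ C? x ⟧ ℤ.* χ y x)

-- Falling factorials and block intersections

ff : ℤ → ℕ → ℤ
ff y zero    = 1ℤ
ff y (suc a) = y ℤ.* ff (y ℤ.- 1ℤ) a

points : Subset n → List (Fin n)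
points []          = []
points (false ∷ W) = map suc (points W)
points (true ∷ W)  = zero ∷ map suc (points W)

length-points : (W : Subset n) → length (points W) ≡ ∣ W ∣
length-points []          = refl
length-points (false ∷ W) = trans (length-map suc (points W)) (length-points W)
length-points (true ∷ W)  = cong suc (trans (length-map suc (points W)) (length-points W))

∈-points : (W : Subset n) {x : Fin n} → x ∈ points W → lookup W x ≡ true
∈-points (false ∷ W) x∈ with ∈-map⁻ suc x∈
... | y , y∈ , refl = ∈-points W y∈
∈-points (true ∷ W) (here refl) = refl
∈-points (true ∷ W) (there x∈) with ∈-map⁻ suc x∈
... | y , y∈ , refl = ∈-points W y∈

Σ-points : (B W : Subset n) → Σ (points W) (λ x → ι (lookup B x)) ≡ + ∣ B ∩ W ∣
Σ-points []          []          = refl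
Σ-points (false ∷ B) (false ∷ W) = trans (Σ-map suc (points W) _) (Σ-points B W)
Σ-points (true ∷ B)  (false ∷ W) = trans (Σ-map suc (points W) _) (Σ-points B W)
Σ-points (false ∷ B) (true ∷ W)  =
  trans (ℤ.+-identityˡ _) (trans (Σ-map suc (points W) _) (Σ-points B W))
Σ-points (true ∷ B)  (true ∷ W)  =
  cong (λ s → 1ℤ ℤ.+ s) (trans (Σ-map suc (points W) _) (Σ-points B W))

incl-add : (S B : Subset n) (x : Fin n) → lookup S x ≡ false →
  incl (S [ x ]≔ true) B ≡ ι (lookup B x) ℤ.* incl S B
incl-add (false ∷ S) (b ∷ B) zero    eq = refl
incl-add (false ∷ S) (b ∷ B) (suc x) eq = incl-add S B x eq
incl-add (true ∷ S)  (b ∷ B) (suc x) eq =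
  trans (cong (λ s → ι b ℤ.* s) (incl-add S B x eq)) (exchange (ι b) (ι (lookup B x)) (incl S B))
  where
  exchange : ∀ p q r → p ℤ.* (q ℤ.* r) ≡ q ℤ.* (p ℤ.* r)
  exchange = solve-∀

size-add : (S : Subset n) (x : Fin n) → lookup S x ≡ false → ∣ S [ x ]≔ true ∣ ≡ suc ∣ S ∣
size-add (false ∷ S) zero    eq = refl
size-add (false ∷ S) (suc x) eq = size-add S x eq
size-add (true ∷ S)  (suc x) eq = cong suc (size-add S x eq)

size-remove : (W : Subset n) (x : Fin n) → lookup W x ≡ true → ∣ W ∣ ≡ suc ∣ W [ x ]≔ false ∣
size-remove (true ∷ W)  zero    eq = refl
size-remove (false ∷ W) (suc x) eq = size-remove W x eq
size-remove (true ∷ W)  (suc x) eq = cong suc (size-remove W x eq)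

meet-remove : (B W : Subset n) (x : Fin n) → lookup B x ≡ true → lookup W x ≡ true →
  ∣ B ∩ W ∣ ≡ suc ∣ B ∩ (W [ x ]≔ false) ∣
meet-remove (true ∷ B)  (true ∷ W)  zero    _  _  = refl
meet-remove (false ∷ B) (w ∷ W)     (suc x) Bx Wx = meet-remove B W x Bx Wx
meet-remove (true ∷ B)  (false ∷ W) (suc x) Bx Wx = meet-remove B W x Bx Wx
meet-remove (true ∷ B)  (true ∷ W)  (suc x) Bx Wx = cong suc (meet-remove B W x Bx Wx)

Disjoint : Subset n → Subset n → Set
Disjoint S W = ∀ x → lookup W x ≡ true → lookup S x ≡ false

disjoint-move : (S W : Subset n) (x : Fin n) → Disjoint S W →
  Disjoint (S [ x ]≔ true) (W [ x ]≔ false)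
disjoint-move S W x dis y Wy with y Fin.≟ x
... | yes refl = contradiction (trans (sym (Vec.lookup∘update x W false)) Wy) λ ()
... | no  y≢x  = trans (Vec.lookup∘update′ y≢x S true)
  (dis y (trans (sym (Vec.lookup∘update′ y≢x W false)) Wy))

pred-+ : ∀ {a b} → a ≡ suc b → + b ≡ + a ℤ.- 1ℤ
pred-+ {b = b} refl = sym (ℤ.m-n≡m⊖n (suc b) 1)

-- A block B ⊇ S meeting W in y points contributes y to the sum over x ∈ W of the blocks
-- containing S ∪ {x}, and then meets W ∖ {x} in y - 1 points.
Σ-ff : (L : List (Subset n)) (κ l : ℤ) (a s : ℕ) →
  (∀ T → ∣ T ∣ ≡ s + a → κ ℤ.* Σ L (incl T) ≡ l) →
  ∀ S W → ∣ S ∣ ≡ s → Disjoint S W →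
  κ ℤ.* Σ L (λ B → incl S B ℤ.* ff (+ ∣ B ∩ W ∣) a) ≡ ff (+ ∣ W ∣) a ℤ.* l
Σ-ff L κ l zero s count S W ∣S∣ dis = begin
  κ ℤ.* Σ L (λ B → incl S B ℤ.* 1ℤ)
    ≡⟨ cong (λ s → κ ℤ.* s) (Σ-cong L (λ B → ℤ.*-identityʳ (incl S B))) ⟩
  κ ℤ.* Σ L (incl S)
    ≡⟨ count S (trans ∣S∣ (sym (ℕ.+-identityʳ s))) ⟩
  l
    ≡⟨ ℤ.*-identityˡ l ⟨
  1ℤ ℤ.* l ∎
  where open ≡-Reasoning
Σ-ff L κ l (suc a) s count S W ∣S∣ dis = begin
  κ ℤ.* Σ L (λ B → incl S B ℤ.* ff (+ ∣ B ∩ W ∣) (suc a))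
    ≡⟨ cong (λ s → κ ℤ.* s) (Σ-cong L spread) ⟩
  κ ℤ.* Σ L (λ B → Σ (points W) (λ x → term x B))
    ≡⟨ cong (λ s → κ ℤ.* s) (Σ-swap L (points W) (λ B x → term x B)) ⟩
  κ ℤ.* Σ (points W) (λ x → Σ L (term x))
    ≡⟨ Σ-*ˡ (points W) κ _ ⟨
  Σ (points W) (λ x → κ ℤ.* Σ L (term x))
    ≡⟨ Σ-cong-∈ (points W) (λ x x∈ → rec x (∈-points W x∈)) ⟩
  Σ (points W) (λ _ → ff (+ ∣ W ∣ ℤ.- 1ℤ) a ℤ.* l)
    ≡⟨ Σ-const (points W) _ ⟩
  + length (points W) ℤ.* (ff (+ ∣ W ∣ ℤ.- 1ℤ) a ℤ.* l)
    ≡⟨ cong (λ s → + s ℤ.* (ff (+ ∣ W ∣ ℤ.- 1ℤ) a ℤ.* l)) (length-points W) ⟩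
  + ∣ W ∣ ℤ.* (ff (+ ∣ W ∣ ℤ.- 1ℤ) a ℤ.* l)
    ≡⟨ ℤ.*-assoc (+ ∣ W ∣) _ l ⟨
  ff (+ ∣ W ∣) (suc a) ℤ.* l ∎
  where
  open ≡-Reasoning
  term : Fin _ → Subset _ → ℤ
  term x B = incl (S [ x ]≔ true) B ℤ.* ff (+ ∣ B ∩ (W [ x ]≔ false) ∣) a
  rec : ∀ x → lookup W x ≡ true → κ ℤ.* Σ L (term x) ≡ ff (+ ∣ W ∣ ℤ.- 1ℤ) a ℤ.* l
  rec x Wx = trans
    (Σ-ff L κ l a (suc s) (λ T eq → count T (trans eq (sym (ℕ.+-suc s a)))) (S [ x ]≔ true) (W [ x ]≔ false)
      (trans (size-add S x (dis x Wx)) (cong suc ∣S∣)) (disjoint-move S W x dis))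
    (cong (λ y → ff y a ℤ.* l) (pred-+ (size-remove W x Wx)))
  spread : ∀ B → incl S B ℤ.* ff (+ ∣ B ∩ W ∣) (suc a) ≡ Σ (points W) (λ x → term x B)
  spread B = sym (begin
    Σ (points W) (λ x → term x B)
      ≡⟨ Σ-cong-∈ (points W) (λ x x∈ → single x (∈-points W x∈)) ⟩
    Σ (points W) (λ x → ι (lookup B x) ℤ.* (incl S B ℤ.* ff (y ℤ.- 1ℤ) a))
      ≡⟨ Σ-*ʳ (points W) _ _ ⟩
    Σ (points W) (λ x → ι (lookup B x)) ℤ.* (incl S B ℤ.* ff (y ℤ.- 1ℤ) a)
      ≡⟨ cong (λ s → s ℤ.* (incl S B ℤ.* ff (y ℤ.- 1ℤ) a)) (Σ-points B W) ⟩
    y ℤ.* (incl S B ℤ.* ff (y ℤ.- 1ℤ) a)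
      ≡⟨ exchange y (incl S B) (ff (y ℤ.- 1ℤ) a) ⟩
    incl S B ℤ.* ff y (suc a) ∎)
    where
    y = + ∣ B ∩ W ∣
    exchange : ∀ p q r → p ℤ.* (q ℤ.* r) ≡ q ℤ.* (p ℤ.* r)
    exchange = solve-∀
    single : ∀ x → lookup W x ≡ true → term x B ≡ ι (lookup B x) ℤ.* (incl S B ℤ.* ff (y ℤ.- 1ℤ) a)
    single x Wx with lookup B x in Bx | incl-add S B x (dis x Wx)
    ... | false | eq = cong (λ s → s ℤ.* ff (+ ∣ B ∩ (W [ x ]≔ false) ∣) a) eq
    ... | true  | eq = trans
      (cong₂ (λ s t → s ℤ.* ff t a) eq (pred-+ (meet-remove B W x Bx Wx)))
      (ℤ.*-assoc 1ℤ (incl S B) _)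

ff-snoc : ∀ y a → ff y (suc a) ≡ ff y a ℤ.* (y ℤ.- + a)
ff-snoc y zero    = first y
  where
  first : ∀ y → y ℤ.* 1ℤ ≡ 1ℤ ℤ.* (y ℤ.- 0ℤ)
  first = solve-∀
ff-snoc y (suc a) = trans (cong (λ s → y ℤ.* s) (ff-snoc (y ℤ.- 1ℤ) a))
  (trans (shift y (ff (y ℤ.- 1ℤ) a) (+ a)) (cong (λ s → ff y (suc a) ℤ.* (y ℤ.- s)) (sym (ℤ.pos-+ 1 a))))
  where
  shift : ∀ y f a → y ℤ.* (f ℤ.* ((y ℤ.- 1ℤ) ℤ.- a)) ≡ y ℤ.* f ℤ.* (y ℤ.- (1ℤ ℤ.+ a))
  shift = solve-∀

ff-+ : ∀ y a b → ff y (a + b) ≡ ff y a ℤ.* ff (y ℤ.- + a) b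
ff-+ y zero    b = trans (cong (λ z → ff z b) (sym (ℤ.+-identityʳ y))) (sym (ℤ.*-identityˡ _))
ff-+ y (suc a) b = begin
  y ℤ.* ff (y ℤ.- 1ℤ) (a + b)
    ≡⟨ cong (λ s → y ℤ.* s) (ff-+ (y ℤ.- 1ℤ) a b) ⟩
  y ℤ.* (ff (y ℤ.- 1ℤ) a ℤ.* ff (y ℤ.- 1ℤ ℤ.- + a) b)
    ≡⟨ ℤ.*-assoc y _ _ ⟨
  ff y (suc a) ℤ.* ff (y ℤ.- 1ℤ ℤ.- + a) b
    ≡⟨ cong (λ z → ff y (suc a) ℤ.* ff z b)
         (trans (shift y (+ a)) (cong (λ s → y ℤ.- s) (sym (ℤ.pos-+ 1 a)))) ⟩
  ff y (suc a) ℤ.* ff (y ℤ.- + suc a) b ∎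
  where
  open ≡-Reasoning
  shift : ∀ y a → y ℤ.- 1ℤ ℤ.- a ≡ y ℤ.- (1ℤ ℤ.+ a)
  shift = solve-∀

-- Integrality of binomial coefficients. Pascal's rule, cleared of denominators, writes
-- `ff (h + 1) (a + 1)` as `ff h (a + 1) + (a + 1) ff h a`, and the factorial divides both summands
-- by induction.
factorial-∣-ff : ∀ a h → + (a !) ∣ᶻ ff (+ h) a
factorial-∣-ff zero    h       = divides 1ℤ refl
factorial-∣-ff (suc a) zero    = divides 0ℤ refl
factorial-∣-ff (suc a) (suc h) = subst (+ (suc a !) ∣ᶻ_) (sym pascal)
  (∣.∣m∣n⇒∣m+n (factorial-∣-ff (suc a) h) (subst (_∣ᶻ + suc a ℤ.* ff (+ h) a) (sym (ℤ.pos-* (suc a) (a !)))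
    (multiple (+ suc a) (factorial-∣-ff a h))))
  where
  open ≡-Reasoning
  multiple : ∀ c {d x} → d ∣ᶻ x → c ℤ.* d ∣ᶻ c ℤ.* x
  multiple c {d} (divides q refl) = divides q (exchange c q d)
    where
    exchange : ∀ c q d → c ℤ.* (q ℤ.* d) ≡ q ℤ.* (c ℤ.* d)
    exchange = solve-∀
  split : ∀ f h a → (1ℤ ℤ.+ h) ℤ.* f ≡ f ℤ.* (h ℤ.- a) ℤ.+ (1ℤ ℤ.+ a) ℤ.* f
  split = solve-∀
  pascal : ff (+ suc h) (suc a) ≡ ff (+ h) (suc a) ℤ.+ + suc a ℤ.* ff (+ h) a
  pascal = begin
    + suc h ℤ.* ff (+ suc h ℤ.- 1ℤ) a
      ≡⟨ cong (λ z → + suc h ℤ.* ff z a) (sym (pred-+ {suc h} refl)) ⟩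
    + suc h ℤ.* ff (+ h) a
      ≡⟨ cong (λ s → s ℤ.* ff (+ h) a) (ℤ.pos-+ 1 h) ⟩
    (1ℤ ℤ.+ + h) ℤ.* ff (+ h) a
      ≡⟨ split (ff (+ h) a) (+ h) (+ a) ⟩
    ff (+ h) a ℤ.* (+ h ℤ.- + a) ℤ.+ (1ℤ ℤ.+ + a) ℤ.* ff (+ h) a
      ≡⟨ cong₂ (λ s t → s ℤ.+ t ℤ.* ff (+ h) a) (sym (ff-snoc (+ h) a)) (sym (ℤ.pos-+ 1 a)) ⟩
    ff (+ h) (suc a) ℤ.+ + suc a ℤ.* ff (+ h) a ∎

-- Power moments of an orthogonal array

-- A coefficient list a₀, a₁, … stands for the polynomial Σ aⱼ y(y-1)⋯(y-j+1).
eval : List ℤ → ℤ → ℤ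
eval []       y = 0ℤ
eval (a ∷ as) y = a ℤ.+ y ℤ.* eval as (y ℤ.- 1ℤ)

addHead : ℤ → List ℤ → List ℤ
addHead c []       = c ∷ []
addHead c (d ∷ ds) = (c ℤ.+ d) ∷ ds

-- Multiplication by `t - y` in the falling factorial basis. For `a + y g(y - 1)` the product is
-- `t a + y (- a + (t - y) g(y - 1))`; since `t - y = (t - 1) - (y - 1)`, the recursion continues
-- with `t - 1`.
mulRoot : ℤ → List ℤ → List ℤ
mulRoot t []       = []
mulRoot t (a ∷ as) = t ℤ.* a ∷ addHead (ℤ.- a) (mulRoot (t ℤ.- 1ℤ) as)

fromRoots : List ℤ → List ℤ
fromRoots = foldr mulRoot (1ℤ ∷ [])

Π : List ℤ → ℤ → ℤ
Π ts y = foldr (λ t s → (t ℤ.- y) ℤ.* s) 1ℤ ts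

eval-addHead : ∀ c ds y → eval (addHead c ds) y ≡ c ℤ.+ eval ds y
eval-addHead c []       y = cong (λ s → c ℤ.+ s) (ℤ.*-zeroʳ y)
eval-addHead c (d ∷ ds) y = ℤ.+-assoc c d _

eval-mulRoot : ∀ t as y → eval (mulRoot t as) y ≡ (t ℤ.- y) ℤ.* eval as y
eval-mulRoot t []       y = sym (ℤ.*-zeroʳ (t ℤ.- y))
eval-mulRoot t (a ∷ as) y = trans
  (cong (λ s → t ℤ.* a ℤ.+ y ℤ.* s)
    (trans (eval-addHead (ℤ.- a) (mulRoot (t ℤ.- 1ℤ) as) (y ℤ.- 1ℤ))
           (cong (λ s → ℤ.- a ℤ.+ s) (eval-mulRoot (t ℤ.- 1ℤ) as (y ℤ.- 1ℤ)))))
  (expand t a y (eval as (y ℤ.- 1ℤ)))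
  where
  expand : ∀ t a y e → t ℤ.* a ℤ.+ y ℤ.* (ℤ.- a ℤ.+ ((t ℤ.- 1ℤ) ℤ.- (y ℤ.- 1ℤ)) ℤ.* e)
                       ≡ (t ℤ.- y) ℤ.* (a ℤ.+ y ℤ.* e)
  expand = solve-∀

eval-fromRoots : ∀ ts y → eval (fromRoots ts) y ≡ Π ts y
eval-fromRoots []       y = cong (λ s → 1ℤ ℤ.+ s) (ℤ.*-zeroʳ y)
eval-fromRoots (t ∷ ts) y = trans (eval-mulRoot t (fromRoots ts) y)
  (cong (λ s → (t ℤ.- y) ℤ.* s) (eval-fromRoots ts y))

Π-root : ∀ {ts y} → y ∈ ts → Π ts y ≡ 0ℤ
Π-root {t ∷ ts} {y} (here refl) =
  trans (cong (λ s → s ℤ.* Π ts y) (ℤ.+-inverseʳ y)) (ℤ.*-zeroˡ (Π ts y))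
Π-root {t ∷ ts} {y} (there y∈) =
  trans (cong (λ s → (t ℤ.- y) ℤ.* s) (Π-root y∈)) (ℤ.*-zeroʳ (t ℤ.- y))

length-mulRoot : ∀ t a as → length (mulRoot t (a ∷ as)) ≡ 2 + length as
length-mulRoot t a []       = refl
length-mulRoot t a (b ∷ as) = cong suc (length-mulRoot (t ℤ.- 1ℤ) b as)

length-fromRoots : ∀ ts → length (fromRoots ts) ≡ suc (length ts)
length-fromRoots []       = refl
length-fromRoots (t ∷ ts) with fromRoots ts | length-fromRoots ts
... | a ∷ as | eq = trans (length-mulRoot t a as) (cong suc eq)

-- 2^e times the mean of a polynomial over a binary orthogonal array: there y(y-1)⋯(y-j+1) has
-- mean n(n-1)⋯(n-j+1) / 2^j.
mean : List ℤ → ℤ → ℕ → ℤ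
mean []       n e = 0ℤ
mean (a ∷ as) n e = a ℤ.* + (2 ^ e) ℤ.+ n ℤ.* mean as (n ℤ.- 1ℤ) (ℕ.pred e)

-- The head coefficient is handled by the `j`-th moment, and the tail is the same claim with one
-- more factor moved into `ff (w x) j`. Thus `j` grows while `e` shrinks and the power of 2 stays
-- fixed. The first length bound keeps `e` large enough for this, the second keeps every moment used
-- below degree `d`.
Σ-eval : (L : List A) (w : A → ℤ) (M N : ℤ) (d : ℕ) →
  (∀ j → j < d → + (2 ^ j) ℤ.* Σ L (λ x → ff (w x) j) ≡ ff N j ℤ.* M) →
  ∀ as j e → length as ≤ suc e → j + length as ≤ d →
  + (2 ^ (j + e)) ℤ.* Σ L (λ x → ff (w x) j ℤ.* eval as (w x ℤ.- + j))
    ≡ ff N j ℤ.* mean as (N ℤ.- + j) e ℤ.* M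
Σ-eval L w M N d moment [] j e _ _ = begin
  P ℤ.* Σ L (λ x → ff (w x) j ℤ.* 0ℤ)
    ≡⟨ cong (λ s → P ℤ.* s) (Σ-zero L (λ x → ℤ.*-zeroʳ (ff (w x) j))) ⟩
  P ℤ.* 0ℤ
    ≡⟨ vanish P (ff N j) M ⟩
  ff N j ℤ.* 0ℤ ℤ.* M ∎
  where
  open ≡-Reasoning
  P = + (2 ^ (j + e))
  vanish : ∀ p f m → p ℤ.* 0ℤ ≡ f ℤ.* 0ℤ ℤ.* m
  vanish = solve-∀
Σ-eval L w M N d moment (a ∷ as) j e len≤ j+len≤ = begin
  P ℤ.* Σ L (λ x → ff (w x) j ℤ.* eval (a ∷ as) (w x ℤ.- + j))
    ≡⟨ cong (λ s → P ℤ.* s) (trans (Σ-cong L split) (trans (Σ-+ L _ _)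
         (cong (λ s → s ℤ.+ V) (Σ-*ˡ L a _)))) ⟩
  P ℤ.* (a ℤ.* U ℤ.+ V)
    ≡⟨ ℤ.*-distribˡ-+ P (a ℤ.* U) V ⟩
  P ℤ.* (a ℤ.* U) ℤ.+ P ℤ.* V
    ≡⟨ cong₂ ℤ._+_ head (tail as e len≤ j+len≤) ⟩
  ff N j ℤ.* (a ℤ.* + (2 ^ e)) ℤ.* M ℤ.+ ff N j ℤ.* (y ℤ.* mean as (y ℤ.- 1ℤ) (ℕ.pred e)) ℤ.* M
    ≡⟨ collect (ff N j) (a ℤ.* + (2 ^ e)) _ M ⟩
  ff N j ℤ.* mean (a ∷ as) y e ℤ.* M ∎
  where
  open ≡-Reasoning
  P = + (2 ^ (j + e))
  y = N ℤ.- + j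
  U = Σ L (λ x → ff (w x) j)
  V = Σ L (λ x → ff (w x) (suc j) ℤ.* eval as (w x ℤ.- + suc j))
  collect : ∀ f p q m → f ℤ.* p ℤ.* m ℤ.+ f ℤ.* q ℤ.* m ≡ f ℤ.* (p ℤ.+ q) ℤ.* m
  collect = solve-∀
  pred-shift : ∀ z → z ℤ.- + j ℤ.- 1ℤ ≡ z ℤ.- + suc j
  pred-shift z = trans (regroup z (+ j)) (cong (λ s → z ℤ.- s) (sym (ℤ.pos-+ 1 j)))
    where
    regroup : ∀ z j → z ℤ.- j ℤ.- 1ℤ ≡ z ℤ.- (1ℤ ℤ.+ j)
    regroup = solve-∀
  split : ∀ x → ff (w x) j ℤ.* eval (a ∷ as) (w x ℤ.- + j)
              ≡ a ℤ.* ff (w x) j ℤ.+ ff (w x) (suc j) ℤ.* eval as (w x ℤ.- + suc j)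
  split x = trans (distribute (ff (w x) j) a (w x ℤ.- + j) (eval as (w x ℤ.- + j ℤ.- 1ℤ)))
    (cong₂ (λ s z → a ℤ.* ff (w x) j ℤ.+ s ℤ.* eval as z) (sym (ff-snoc (w x) j)) (pred-shift (w x)))
    where
    distribute : ∀ f a y e → f ℤ.* (a ℤ.+ y ℤ.* e) ≡ a ℤ.* f ℤ.+ f ℤ.* y ℤ.* e
    distribute = solve-∀
  head : P ℤ.* (a ℤ.* U) ≡ ff N j ℤ.* (a ℤ.* + (2 ^ e)) ℤ.* M
  head = begin
    P ℤ.* (a ℤ.* U)
      ≡⟨ cong (λ s → s ℤ.* (a ℤ.* U)) (trans (cong +_ (ℕ.^-distribˡ-+-* 2 j e)) (ℤ.pos-* (2 ^ j) (2 ^ e))) ⟩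
    + (2 ^ j) ℤ.* + (2 ^ e) ℤ.* (a ℤ.* U)
      ≡⟨ regroup (+ (2 ^ j)) (+ (2 ^ e)) a U ⟩
    a ℤ.* + (2 ^ e) ℤ.* (+ (2 ^ j) ℤ.* U)
      ≡⟨ cong (λ s → a ℤ.* + (2 ^ e) ℤ.* s)
           (moment j (ℕ.<-≤-trans (ℕ.m<m+n j (s≤s z≤n)) j+len≤)) ⟩
    a ℤ.* + (2 ^ e) ℤ.* (ff N j ℤ.* M)
      ≡⟨ regroup′ (a ℤ.* + (2 ^ e)) (ff N j) M ⟩
    ff N j ℤ.* (a ℤ.* + (2 ^ e)) ℤ.* M ∎
    where
    regroup : ∀ p q a u → p ℤ.* q ℤ.* (a ℤ.* u) ≡ a ℤ.* q ℤ.* (p ℤ.* u)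
    regroup = solve-∀
    regroup′ : ∀ p f m → p ℤ.* (f ℤ.* m) ≡ f ℤ.* p ℤ.* m
    regroup′ = solve-∀
  tail : ∀ as e → suc (length as) ≤ suc e → j + suc (length as) ≤ d →
    + (2 ^ (j + e)) ℤ.* Σ L (λ x → ff (w x) (suc j) ℤ.* eval as (w x ℤ.- + suc j))
      ≡ ff N j ℤ.* (y ℤ.* mean as (y ℤ.- 1ℤ) (ℕ.pred e)) ℤ.* M
  -- Only here may `e` be zero, so that `pred e` truncates; this is harmless because the mean of the
  -- empty list is 0.
  tail [] e len≤ _ = begin
    + (2 ^ (j + e)) ℤ.* Σ L (λ x → ff (w x) (suc j) ℤ.* 0ℤ)
      ≡⟨ cong (λ s → + (2 ^ (j + e)) ℤ.* s) (Σ-zero L (λ x → ℤ.*-zeroʳ (ff (w x) (suc j)))) ⟩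
    + (2 ^ (j + e)) ℤ.* 0ℤ
      ≡⟨ vanish (+ (2 ^ (j + e))) (ff N j) y M ⟩
    ff N j ℤ.* (y ℤ.* 0ℤ) ℤ.* M ∎
    where
    vanish : ∀ p f y m → p ℤ.* 0ℤ ≡ f ℤ.* (y ℤ.* 0ℤ) ℤ.* m
    vanish = solve-∀
  tail (b ∷ bs) (suc e) (s≤s len≤) j+len≤ = begin
    + (2 ^ (j + suc e)) ℤ.* S
      ≡⟨ cong (λ s → + (2 ^ s) ℤ.* S) (ℕ.+-suc j e) ⟩
    + (2 ^ (suc j + e)) ℤ.* S
      ≡⟨ Σ-eval L w M N d moment (b ∷ bs) (suc j) e len≤ (subst (_≤ d) (ℕ.+-suc j _) j+len≤) ⟩
    ff N (suc j) ℤ.* mean (b ∷ bs) (N ℤ.- + suc j) e ℤ.* M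
      ≡⟨ cong₂ (λ s z → s ℤ.* mean (b ∷ bs) z e ℤ.* M) (ff-snoc N j) (sym (pred-shift N)) ⟩
    ff N j ℤ.* y ℤ.* mean (b ∷ bs) (y ℤ.- 1ℤ) e ℤ.* M
      ≡⟨ cong (λ s → s ℤ.* M) (ℤ.*-assoc (ff N j) y (mean (b ∷ bs) (y ℤ.- 1ℤ) e)) ⟩
    ff N j ℤ.* (y ℤ.* mean (b ∷ bs) (y ℤ.- 1ℤ) e) ℤ.* M ∎
    where
    S = Σ L (λ x → ff (w x) (suc j) ℤ.* eval (b ∷ bs) (w x ℤ.- + suc j))

-- Parity of intersections

odd : ℕ → Bool
odd zero    = false
odd (suc k) = not (odd k)

⟨⟩-odd : (x y : Word n) → ⟨ x , y ⟩ ≡ odd ∣ x ∩ y ∣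
⟨⟩-odd []          []          = refl
⟨⟩-odd (false ∷ x) (b ∷ y)     = ⟨⟩-odd x y
⟨⟩-odd (true ∷ x)  (false ∷ y) = ⟨⟩-odd x y
⟨⟩-odd (true ∷ x)  (true ∷ y)  = cong not (⟨⟩-odd x y)

even-half : ∀ k → odd k ≡ false → ∃ λ h → k ≡ h + h
even-half zero          _  = 0 , refl
even-half (suc (suc k)) eq with even-half k (trans (sym (Bool.not-involutive (odd k))) eq)
... | h , refl = suc h , cong suc (sym (ℕ.+-suc h h))

4∣⇒even : ∀ {k} → 4 ℕ∣.∣ k → odd k ≡ false
4∣⇒even (ℕ∣.divides zero refl)    = refl
4∣⇒even (ℕ∣.divides (suc q) refl) = trans (Bool.not-involutive _)
  (trans (Bool.not-involutive _) (4∣⇒even (ℕ∣.divides q refl)))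

-- Complements, and points inside or outside a set.

∁≡ : (x : Word n) → ∁ x ≡ x ⊕ ⊤
∁≡ []          = refl
∁≡ (false ∷ x) = cong (true ∷_) (∁≡ x)
∁≡ (true ∷ x)  = cong (false ∷_) (∁≡ x)

∣x∣+∣∁x∣ : (x : Word n) → ∣ x ∣ + ∣ ∁ x ∣ ≡ n
∣x∣+∣∁x∣ []          = refl
∣x∣+∣∁x∣ (false ∷ x) = trans (ℕ.+-suc ∣ x ∣ ∣ ∁ x ∣) (cong suc (∣x∣+∣∁x∣ x))
∣x∣+∣∁x∣ (true ∷ x)  = cong suc (∣x∣+∣∁x∣ x)

incl-zeroWord : (B : Subset n) → incl zeroWord B ≡ 1ℤ
incl-zeroWord []      = refl
incl-zeroWord (b ∷ B) = incl-zeroWord B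

disjoint-∁ : (S : Subset n) → Disjoint S (∁ S)
disjoint-∁ (false ∷ S) zero    _  = refl
disjoint-∁ (s ∷ S)     (suc x) eq = disjoint-∁ S x eq

disjoint-zeroWord : (W : Subset n) → Disjoint zeroWord W
disjoint-zeroWord W x _ = Vec.lookup-replicate x false

-- For blocks of a fixed size this determines the number of points of `B` outside `S` whenever the
-- indicator does not vanish.
incl-∁ : (S B : Subset n) → incl S B ≡ 0ℤ ⊎ ∣ S ∣ + ∣ B ∩ ∁ S ∣ ≡ ∣ B ∣
incl-∁ []          []          = inj₂ refl
incl-∁ (true ∷ S)  (false ∷ B) = inj₁ (ℤ.*-zeroˡ (incl S B))
incl-∁ (true ∷ S)  (true ∷ B)  with incl-∁ S B
... | inj₁ eq = inj₁ (trans (ℤ.*-identityˡ (incl S B)) eq)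
... | inj₂ eq = inj₂ (cong suc eq)
incl-∁ (false ∷ S) (false ∷ B) = incl-∁ S B
incl-∁ (false ∷ S) (true ∷ B)  with incl-∁ S B
... | inj₁ eq = inj₁ eq
... | inj₂ eq = inj₂ (trans (ℕ.+-suc ∣ S ∣ ∣ B ∩ ∁ S ∣) (cong suc eq))

∃-inside : (T : Subset n) → 0 < ∣ T ∣ → ∃ λ p → lookup T p ≡ true
∃-inside (true ∷ T)  _   = zero , refl
∃-inside (false ∷ T) 0<T with ∃-inside T 0<T
... | p , eq = suc p , eq

∃-outside : (T : Subset n) → ∣ T ∣ < n → ∃ λ q → lookup T q ≡ false
∃-outside (false ∷ T) _         = zero , refl
∃-outside (true ∷ T)  (s≤s T<n) with ∃-outside T T<n
... | q , eq = suc q , eq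

Σ-length : (xs : List A) {f : A → ℤ} → (∀ x → f x ≡ 1ℤ) → Σ xs f ≡ + length xs
Σ-length xs eq = trans (Σ-cong xs eq) (trans (Σ-const xs 1ℤ) (ℤ.*-identityʳ _))

-- The quartic in the intersection size and its divisibility by 384.

-- The expansion (y+1)(y-1)(y-3)(y-5) = Σ γₐ y(y-1)⋯(y-a+1).
γ : ℕ → ℤ
γ 0 = ℤ.- (+ 15)
γ 1 = + 15
γ 2 = ℤ.- (+ 3)
γ 3 = ℤ.- (+ 2)
γ _ = 1ℤ

-- The falling factorial of degree `a` is replaced by an arbitrary `f a`, so that one linear
-- combination applies to a single intersection size, to sums over blocks and to their closed forms.
combine : (ℕ → ℤ) → ℤ
combine f = Σ (upTo 5) (λ a → γ a ℤ.* f a)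

-- For `y = 2h - 1` the four factors are `2h`, `2h - 2`, `2h - 4`, `2h - 6`. Their product is 16
-- times `ff h 4`, and 4! = 24 divides the latter.
384-∣-combine : ∀ y h → suc y ≡ h + h → + 384 ∣ᶻ combine (ff (+ y))
384-∣-combine y h eq with factorial-∣-ff 4 h
... | divides q eq′ = divides q (begin
  combine (ff (+ y))
    ≡⟨ cong (λ z → combine (ff z)) (trans (pred-+ (sym eq)) (cong (λ s → s ℤ.- 1ℤ) (ℤ.pos-+ h h))) ⟩
  combine (ff (+ h ℤ.+ + h ℤ.- 1ℤ))
    ≡⟨ halve (+ h) ⟩
  + 16 ℤ.* ff (+ h) 4
    ≡⟨ cong (λ s → + 16 ℤ.* s) eq′ ⟩
  + 16 ℤ.* (q ℤ.* + 24)
    ≡⟨ regroup q ⟩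
  q ℤ.* + 384 ∎)
  where
  open ≡-Reasoning
  regroup : ∀ q → + 16 ℤ.* (q ℤ.* + 24) ≡ q ℤ.* + 384
  regroup = solve-∀
  -- The left side is `combine (ff (h + h - 1))` fully unfolded, which presents it to the ring
  -- solver as a polynomial in `h`.
  halve : ∀ h → ℤ.- (+ 15) ℤ.* 1ℤ ℤ.+ (+ 15 ℤ.* ((h ℤ.+ h ℤ.- 1ℤ) ℤ.* 1ℤ) ℤ.+
    (ℤ.- (+ 3) ℤ.* ((h ℤ.+ h ℤ.- 1ℤ) ℤ.* ((h ℤ.+ h ℤ.- 1ℤ ℤ.- 1ℤ) ℤ.* 1ℤ)) ℤ.+
    (ℤ.- (+ 2) ℤ.* ((h ℤ.+ h ℤ.- 1ℤ) ℤ.* ((h ℤ.+ h ℤ.- 1ℤ ℤ.- 1ℤ) ℤ.*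
      ((h ℤ.+ h ℤ.- 1ℤ ℤ.- 1ℤ ℤ.- 1ℤ) ℤ.* 1ℤ))) ℤ.+
    (1ℤ ℤ.* ((h ℤ.+ h ℤ.- 1ℤ) ℤ.* ((h ℤ.+ h ℤ.- 1ℤ ℤ.- 1ℤ) ℤ.*
      ((h ℤ.+ h ℤ.- 1ℤ ℤ.- 1ℤ ℤ.- 1ℤ) ℤ.* ((h ℤ.+ h ℤ.- 1ℤ ℤ.- 1ℤ ℤ.- 1ℤ ℤ.- 1ℤ) ℤ.* 1ℤ)))) ℤ.+ 0ℤ))))
    ≡ + 16 ℤ.* (h ℤ.* ((h ℤ.- 1ℤ) ℤ.* ((h ℤ.- 1ℤ ℤ.- 1ℤ) ℤ.* ((h ℤ.- 1ℤ ℤ.- 1ℤ ℤ.- 1ℤ) ℤ.* 1ℤ))))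
  halve = solve-∀

-- The minimum weight design of an extremal code

-- 0, 24m and 4m+8, 4m+12, …, 20m-4: all weights of the code except 4m+4.
otherWeights : ℕ → List ℤ
otherWeights m = 0ℤ ∷ + (24 * m) ∷ map (λ i → + (4 * (m + 2 + i))) (upTo (4 * m ∸ 2))

-- Numerator and denominator of the sum over the blocks through `p` and `q`, divided by 384. The sum
-- is a multiple of λ₇ with denominator `ff (k - 2) 5`; λ₇ is `b ff k 7 / ff v 7`; and `b` is the
-- scaled mean of the product over the other weights times `2 ^ (12 * m)`, divided by the scaled
-- value of that product at `k`.
divisor dividend : ℕ → ℤ
divisor m = + 384 ℤ.* ff (k ℤ.- + 2) 5 ℤ.* (ff v 7 ℤ.* (Π (otherWeights m) k ℤ.* + (2 ^ length (otherWeights m))))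
  where
  k = + (4 * m + 4)
  v = + (24 * m)
dividend m = combine (λ a → ff (k ℤ.- + 2) a ℤ.* (ff (k ℤ.- 1ℤ) a ℤ.* ff (v ℤ.- + (2 + a)) (5 ∸ a)))
  ℤ.* (ff k 7 ℤ.* (mean (fromRoots (otherWeights m)) v (length (otherWeights m)) ℤ.* + (2 ^ (12 * m))))
  where
  k = + (4 * m + 4)
  v = + (24 * m)

module Extremal (m : ℕ) (1≤m : 1 ≤ m) (C : Code (24 * m)) (C? : Decidable C) (ext : IsExtremalDESD m C C?) where

  v k : ℕ
  v = 24 * m
  k = 4 * m + 4

  lin : IsLinear C
  lin = proj₁ ext
  sd : IsSelfDual C
  sd = proj₁ (proj₂ ext)
  doublyEven : IsDoublyEven C
  doublyEven = proj₁ (proj₂ (proj₂ ext))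
  dim : HasDimension C C? (12 * m)
  dim = proj₁ (proj₂ (proj₂ (proj₂ ext)))
  minWeight : ∀ x → C x → ¬ x ≡ zeroWord → k ≤ wt x
  minWeight = proj₁ (proj₂ (proj₂ (proj₂ (proj₂ ext))))

  isBlock? : Decidable (λ x → C x × wt x ≡ k)
  isBlock? x = C? x ×-dec (wt x ℕ.≟ k)

  blocks : List (Subset v)
  blocks = Design.blocks (supportDesign C C? k)

  ∈-blocks : ∀ {B} → B ∈ blocks → C B × wt B ≡ k
  ∈-blocks B∈ with ∈-map⁻ support B∈
  ... | B , B∈′ , refl = proj₂ (∈-filter⁻ isBlock? {xs = allWords v} B∈′)

  meet-even : ∀ {x y} → C x → C y → ∃ λ h → ∣ x ∩ y ∣ ≡ h + h
  meet-even {x} {y} Cx Cy = even-half _ (trans (sym (⟨⟩-odd x y)) (proj₁ (sd x) Cx y Cy))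

  -- All weights are even, so the all-one word is orthogonal to every codeword and belongs to `C` by
  -- self-duality.
  ∁-closed : ∀ x → C x → C (∁ x)
  ∁-closed x Cx = subst C (sym (∁≡ x)) (proj₂ lin x ⊤ Cx (proj₂ (sd ⊤) dual))
    where
    dual : Dual C ⊤
    dual y Cy = trans (⟨⟩-odd ⊤ y)
      (trans (cong (odd ∘ ∣_∣) (Sub.∩-identityˡ y)) (4∣⇒even (doublyEven y Cy)))

  -- Apart from the zero word and the all-one word, both `x` and its complement have weight at least
  -- `k`. With weight `4q` different from `k` this leaves `m + 2 ≤ q ≤ 5m - 1`, and `q - (m + 2)` is
  -- the position in the list.
  weight∈ : ∀ x → C x → ¬ wt x ≡ k → + wt x ∈ otherWeights m
  weight∈ x Cx wt≢k with Vec.≡-dec Bool._≟_ x zeroWord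
  ... | yes refl = here (cong +_ (Sub.∣⊥∣≡0 v))
  ... | no x≢0 with Vec.≡-dec Bool._≟_ (∁ x) zeroWord
  ...   | yes ∁x≡0 = there (here (cong +_ (begin
    wt x                     ≡⟨ ℕ.+-identityʳ (wt x) ⟨
    wt x + 0                 ≡⟨ cong (λ s → wt x + s) (Sub.∣⊥∣≡0 v) ⟨
    wt x + ∣ zeroWord {v} ∣  ≡⟨ cong (λ z → wt x + ∣ z ∣) ∁x≡0 ⟨
    wt x + wt (∁ x)          ≡⟨ ∣x∣+∣∁x∣ x ⟩
    v                        ∎)))
    where open ≡-Reasoning
  ...   | no ∁x≢0 with doublyEven x Cx
  ...     | ℕ∣.divides q wt≡ = there (there (subst (_∈ map (λ i → + (4 * (m + 2 + i))) (upTo (4 * m ∸ 2)))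
    (cong +_ (trans (cong (4 *_) (ℕ.m+[n∸m]≡n m+2≤q)) (sym wt≡4q))) (∈-map⁺ _ (∈-upTo⁺ i<))))
    where
    wt≡4q : wt x ≡ 4 * q
    wt≡4q = trans wt≡ (ℕ.*-comm q 4)
    k≡ : k ≡ 4 * (m + 1)
    k≡ = sym (ℕ.*-distribˡ-+ 4 m 1)
    m+1≤q : m + 1 ≤ q
    m+1≤q = ℕ.*-cancelˡ-≤ 4 (subst₂ _≤_ k≡ wt≡4q (minWeight x Cx x≢0))
    m+2≤q : m + 2 ≤ q
    m+2≤q = subst (_≤ q) (sym (ℕ.+-suc m 1))
      (ℕ.≤∧≢⇒< m+1≤q (λ eq → wt≢k (trans wt≡4q (trans (cong (4 *_) (sym eq)) (sym k≡)))))
    q+[m+1]≤6m : q + (m + 1) ≤ 6 * m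
    q+[m+1]≤6m = ℕ.*-cancelˡ-≤ 4 (begin
      4 * (q + (m + 1))        ≡⟨ ℕ.*-distribˡ-+ 4 q (m + 1) ⟩
      4 * q + 4 * (m + 1)      ≡⟨ cong₂ _+_ wt≡4q k≡ ⟨
      wt x + k                 ≤⟨ ℕ.+-monoʳ-≤ (wt x) (minWeight (∁ x) (∁-closed x Cx) ∁x≢0) ⟩
      wt x + wt (∁ x)          ≡⟨ ∣x∣+∣∁x∣ x ⟩
      24 * m                   ≡⟨ ℕ.*-assoc 4 6 m ⟩
      4 * (6 * m)              ∎)
      where open ℕ.≤-Reasoning
    i<  : q ∸ (m + 2) < 4 * m ∸ 2
    i< = ℕ.m+n≤o⇒m≤o∸n (suc (q ∸ (m + 2))) {2} {4 * m} (ℕ.+-cancelʳ-≤ (m + m) _ _ (begin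
      suc (q ∸ (m + 2)) + 2 + (m + m)     ≡⟨ regroup (q ∸ (m + 2)) m ⟩
      (m + 2 + (q ∸ (m + 2))) + (m + 1)   ≡⟨ cong (λ s → s + (m + 1)) (ℕ.m+[n∸m]≡n m+2≤q) ⟩
      q + (m + 1)                         ≤⟨ q+[m+1]≤6m ⟩
      6 * m                               ≡⟨ six m ⟩
      4 * m + (m + m)                     ∎))
      where
      open ℕ.≤-Reasoning
      regroup : ∀ i m → suc i + 2 + (m + m) ≡ (m + 2 + i) + (m + 1)
      regroup = ℕSolver.solve-∀
      six : ∀ m → 6 * m ≡ 4 * m + (m + m)
      six = ℕSolver.solve-∀

  length-otherWeights : length (otherWeights m) ≡ 4 * m
  length-otherWeights = trans (cong (λ s → 2 + s) (trans (length-map _ (upTo (4 * m ∸ 2))) (length-upTo (4 * m ∸ 2))))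
    (ℕ.m+[n∸m]≡n (ℕ.≤-trans (s≤s (s≤s z≤n)) (ℕ.*-monoʳ-≤ 4 1≤m)))

  -- Weight moments of the code and the number of blocks.

  codewords : List (Word v)
  codewords = filter C? (allWords v)

  -- This is `Σ-ff` for the empty set and the set of all points, where the intersection size is the
  -- weight. The scaling `2 ^ j` is the one under which `strength` counts the codewords containing
  -- `j` given points, and it requires `j < k`.
  weightMoment : ∀ j → j < k → + (2 ^ j) ℤ.* Σ codewords (λ x → ff (+ wt x) j) ≡ ff (+ v) j ℤ.* + (2 ^ (12 * m))
  weightMoment j j<k = begin
    + (2 ^ j) ℤ.* Σ codewords (λ x → ff (+ wt x) j)
      ≡⟨ cong (λ s → + (2 ^ j) ℤ.* s) (Σ-cong codewords (λ x → sym (trans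
           (cong₂ (λ s B → s ℤ.* ff (+ ∣ B ∣) j) (incl-zeroWord x) (Sub.∩-identityʳ x)) (ℤ.*-identityˡ _)))) ⟩
    + (2 ^ j) ℤ.* Σ codewords (λ x → incl zeroWord x ℤ.* ff (+ ∣ x ∩ ⊤ ∣) j)
      ≡⟨ Σ-ff codewords (+ (2 ^ j)) _ j 0 array zeroWord ⊤ (Sub.∣⊥∣≡0 v) (disjoint-zeroWord ⊤) ⟩
    ff (+ ∣ ⊤ {v} ∣) j ℤ.* + (2 ^ (12 * m))
      ≡⟨ cong (λ s → ff (+ s) j ℤ.* + (2 ^ (12 * m))) (Sub.∣⊤∣≡n v) ⟩
    ff (+ v) j ℤ.* + (2 ^ (12 * m)) ∎
    where
    open ≡-Reasoning
    array : ∀ T → ∣ T ∣ ≡ 0 + j → + (2 ^ j) ℤ.* Σ codewords (incl T) ≡ + (2 ^ (12 * m))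
    array T refl = trans (SelfDual.strength C C? lin sd k minWeight T j<k) (cong +_ dim)

  b : ℤ
  b = + length blocks

  -- Every codeword weight other than `k` is a root of the product, so only the blocks contribute,
  -- all with the same value.
  Σ-Π : Σ codewords (λ x → Π (otherWeights m) (+ wt x)) ≡ b ℤ.* Π (otherWeights m) (+ k)
  Σ-Π = begin
    Σ codewords (λ x → Π ts (+ wt x))
      ≡⟨ Σ-filter C? (allWords v) _ ⟩
    Σ (allWords v) (λ x → ⟦ C? x ⟧ ℤ.* Π ts (+ wt x))
      ≡⟨ Σ-cong (allWords v) term ⟩
    Σ (allWords v) (λ x → ⟦ isBlock? x ⟧ ℤ.* Π ts (+ k))
      ≡⟨ Σ-*ʳ (allWords v) (Π ts (+ k)) _ ⟩
    Σ (allWords v) (λ x → ⟦ isBlock? x ⟧) ℤ.* Π ts (+ k)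
      ≡⟨ cong (λ s → s ℤ.* Π ts (+ k)) (trans (sym (length-filter isBlock? (allWords v)))
           (cong +_ (sym (length-map support (filter isBlock? (allWords v)))))) ⟩
    b ℤ.* Π ts (+ k) ∎
    where
    open ≡-Reasoning
    ts = otherWeights m
    term : ∀ x → ⟦ C? x ⟧ ℤ.* Π ts (+ wt x) ≡ ⟦ isBlock? x ⟧ ℤ.* Π ts (+ k)
    term x = byCases (C? x) (wt x ℕ.≟ k)
      where
      byCases : (p : Dec (C x)) (q : Dec (wt x ≡ k)) →
        ⟦ p ⟧ ℤ.* Π ts (+ wt x) ≡ ⟦ p ×-dec q ⟧ ℤ.* Π ts (+ k)
      byCases (no _)   q        = refl
      byCases (yes _)  (yes eq) = cong (λ w → 1ℤ ℤ.* Π ts (+ w)) eq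
      byCases (yes Cx) (no neq) = cong (λ s → 1ℤ ℤ.* s) (Π-root (weight∈ x Cx neq))

  -- The sum of the product over the code is computed twice: by `Σ-Π` through the blocks, and by
  -- `Σ-eval` through the moments of low degree.
  blockCount : b ℤ.* (Π (otherWeights m) (+ k) ℤ.* + (2 ^ length (otherWeights m)))
    ≡ mean (fromRoots (otherWeights m)) (+ v) (length (otherWeights m)) ℤ.* + (2 ^ (12 * m))
  blockCount = begin
    b ℤ.* (Π ts (+ k) ℤ.* P)
      ≡⟨ regroup b (Π ts (+ k)) P ⟩
    P ℤ.* (b ℤ.* Π ts (+ k))
      ≡⟨ cong (λ s → P ℤ.* s) Σ-Π ⟨
    P ℤ.* Σ codewords (λ x → Π ts (+ wt x))
      ≡⟨ cong (λ s → P ℤ.* s) (Σ-cong codewords (λ x → trans (sym (eval-fromRoots ts (+ wt x)))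
           (trans (cong (eval (fromRoots ts)) (sym (ℤ.+-identityʳ (+ wt x)))) (sym (ℤ.*-identityˡ _))))) ⟩
    P ℤ.* Σ codewords (λ x → 1ℤ ℤ.* eval (fromRoots ts) (+ wt x ℤ.- 0ℤ))
      ≡⟨ Σ-eval codewords (λ x → + wt x) M (+ v) k weightMoment (fromRoots ts) 0 (length ts)
           (ℕ.≤-reflexive (length-fromRoots ts)) degree ⟩
    1ℤ ℤ.* mean (fromRoots ts) (+ v ℤ.- 0ℤ) (length ts) ℤ.* M
      ≡⟨ cong (λ s → s ℤ.* M) (trans (ℤ.*-identityˡ _)
           (cong (λ z → mean (fromRoots ts) z (length ts)) (ℤ.+-identityʳ (+ v)))) ⟩
    mean (fromRoots ts) (+ v) (length ts) ℤ.* M ∎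
    where
    open ≡-Reasoning
    ts = otherWeights m
    P = + (2 ^ length ts)
    M = + (2 ^ (12 * m))
    regroup : ∀ b p q → b ℤ.* (p ℤ.* q) ≡ q ℤ.* (b ℤ.* p)
    regroup = solve-∀
    -- A product of `4m` factors has `4m + 1` coefficients, and the moments of degree below `4m + 4`
    -- are available.
    degree : length (fromRoots ts) ≤ k
    degree = subst (_≤ k) (sym (trans (length-fromRoots ts)
      (trans (cong suc length-otherWeights) (ℕ.+-comm 1 (4 * m))))) (ℕ.+-monoʳ-≤ (4 * m) (s≤s z≤n))

  -- Block counts in a hypothetical 7-design.

  module SevenDesign (λ₇ : ℕ) (count : ∀ T → ∣ T ∣ ≡ 7 → countContaining (supportDesign C C? k) T ≡ λ₇) where

    l : ℤ
    l = + λ₇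

    Σ-incl : ∀ T → ∣ T ∣ ≡ 7 → Σ blocks (incl T) ≡ l
    Σ-incl T ∣T∣ = trans (Σ-cong blocks (λ B → sym (⟦⊆?⟧ T B)))
      (trans (sym (length-filter (T Sub.⊆?_) blocks)) (cong +_ (count T ∣T∣)))

    -- Double counting of a block through `S` together with an ordered choice of `r` distinct points
    -- of it outside `S`: each such block allows `ff (k - s) r` choices, and each choice completes
    -- `S` to a 7-set lying in λ₇ blocks.
    Σ-incl-smaller : ∀ s r → s + r ≡ 7 → ∀ S → ∣ S ∣ ≡ s →
      ff (+ k ℤ.- + s) r ℤ.* Σ blocks (incl S) ≡ ff (+ v ℤ.- + s) r ℤ.* l
    Σ-incl-smaller s r s+r≡7 S ∣S∣ = begin
      ff (+ k ℤ.- + s) r ℤ.* Σ blocks (incl S)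
        ≡⟨ Σ-*ˡ blocks (ff (+ k ℤ.- + s) r) (incl S) ⟨
      Σ blocks (λ B → ff (+ k ℤ.- + s) r ℤ.* incl S B)
        ≡⟨ Σ-cong-∈ blocks (λ B B∈ → sym (rest B (proj₂ (∈-blocks B∈)))) ⟩
      Σ blocks (λ B → incl S B ℤ.* ff (+ ∣ B ∩ ∁ S ∣) r)
        ≡⟨ ℤ.*-identityˡ _ ⟨
      1ℤ ℤ.* Σ blocks (λ B → incl S B ℤ.* ff (+ ∣ B ∩ ∁ S ∣) r)
        ≡⟨ Σ-ff blocks 1ℤ l r s (λ T eq → trans (ℤ.*-identityˡ _) (Σ-incl T (trans eq s+r≡7)))
             S (∁ S) ∣S∣ (disjoint-∁ S) ⟩
      ff (+ ∣ ∁ S ∣) r ℤ.* l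
        ≡⟨ cong (λ z → ff z r ℤ.* l) (complement (trans (cong (_+ ∣ ∁ S ∣) (sym ∣S∣)) (∣x∣+∣∁x∣ S))) ⟩
      ff (+ v ℤ.- + s) r ℤ.* l ∎
      where
      open ≡-Reasoning
      complement : ∀ {x y} → s + x ≡ y → + x ≡ + y ℤ.- + s
      complement {x} refl = sym (trans (cong (λ z → z ℤ.- + s) (ℤ.pos-+ s x)) (cancel (+ s) (+ x)))
        where
        cancel : ∀ s x → s ℤ.+ x ℤ.- s ≡ x
        cancel = solve-∀
      rest : ∀ B → wt B ≡ k → incl S B ℤ.* ff (+ ∣ B ∩ ∁ S ∣) r ≡ ff (+ k ℤ.- + s) r ℤ.* incl S B
      rest B wtB with incl-∁ S B
      ... | inj₁ eq rewrite eq = sym (ℤ.*-zeroʳ (ff (+ k ℤ.- + s) r))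
      ... | inj₂ eq = trans (cong (λ z → incl S B ℤ.* ff z r)
        (complement (trans (cong (_+ ∣ B ∩ ∁ S ∣) (sym ∣S∣)) (trans eq wtB)))) (ℤ.*-comm (incl S B) _)

    b-λ₇ : b ℤ.* ff (+ k) 7 ≡ ff (+ v) 7 ℤ.* l
    b-λ₇ = begin
      b ℤ.* ff (+ k) 7
        ≡⟨ ℤ.*-comm b (ff (+ k) 7) ⟩
      ff (+ k) 7 ℤ.* b
        ≡⟨ cong₂ (λ z s → ff z 7 ℤ.* s) (sym (ℤ.+-identityʳ (+ k))) (sym (Σ-length blocks incl-zeroWord)) ⟩
      ff (+ k ℤ.- 0ℤ) 7 ℤ.* Σ blocks (incl zeroWord)
        ≡⟨ Σ-incl-smaller 0 7 refl zeroWord (Sub.∣⊥∣≡0 v) ⟩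
      ff (+ v ℤ.- 0ℤ) 7 ℤ.* l
        ≡⟨ cong (λ z → ff z 7 ℤ.* l) (ℤ.+-identityʳ (+ v)) ⟩
      ff (+ v) 7 ℤ.* l ∎
      where open ≡-Reasoning

    -- Intersections of a block `T` with the blocks through a point inside and a point outside it.

    module TwoPoints (T : Subset v) (CT : C T) (wtT : wt T ≡ k)
      (p q : Fin v) (p∈T : lookup T p ≡ true) (q∉T : lookup T q ≡ false) where

      S₁ S₂ W : Subset v
      S₁ = zeroWord [ p ]≔ true
      S₂ = S₁ [ q ]≔ true
      W  = T [ p ]≔ false

      q≢p : ¬ q ≡ p
      q≢p refl = contradiction (trans (sym q∉T) p∈T) λ ()

      q∉S₁ : lookup S₁ q ≡ false
      q∉S₁ = trans (Vec.lookup∘update′ q≢p zeroWord true) (Vec.lookup-replicate q false)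

      p∉zero : lookup (zeroWord {v}) p ≡ false
      p∉zero = Vec.lookup-replicate p false

      ∣S₂∣ : ∣ S₂ ∣ ≡ 2
      ∣S₂∣ = trans (size-add S₁ q q∉S₁) (cong suc (trans (size-add zeroWord p p∉zero) (cong suc (Sub.∣⊥∣≡0 v))))

      ∣W∣ : + ∣ W ∣ ≡ + k ℤ.- 1ℤ
      ∣W∣ = pred-+ (trans (sym wtT) (size-remove T p p∈T))

      disjoint : Disjoint S₂ W
      disjoint y Wy with y Fin.≟ q
      ... | yes refl = contradiction (trans (sym (trans (Vec.lookup∘update′ q≢p T false) q∉T)) Wy) λ ()
      ... | no  y≢q  = trans (Vec.lookup∘update′ y≢q S₁ true)
        (disjoint-move zeroWord T p (disjoint-zeroWord T) y Wy)

      X : ℕ → ℤ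
      X a = Σ blocks (λ B → incl S₂ B ℤ.* ff (+ ∣ B ∩ W ∣) a)

      K : ℤ
      K = ff (+ k ℤ.- + 2) 5

      R : ℕ → ℤ
      R a = ff (+ k ℤ.- + 2) a ℤ.* (ff (+ k ℤ.- 1ℤ) a ℤ.* ff (+ v ℤ.- + (2 + a)) (5 ∸ a))

      -- `Σ-ff` reduces the moment to the number of blocks through `2 + a` points, known after
      -- scaling by `ff (k - (2 + a)) (5 - a)`. The further factor `ff (k - 2) a` completes this
      -- scaling to `K`, the same for all `a`, so that the moments can be combined.
      K*X : ∀ a → a ≤ 5 → K ℤ.* X a ≡ R a ℤ.* l
      K*X a a≤5 = begin
        ff κ 5 ℤ.* X a
          ≡⟨ cong (λ r → ff κ r ℤ.* X a) (ℕ.m+[n∸m]≡n a≤5) ⟨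
        ff κ (a + r) ℤ.* X a
          ≡⟨ cong (λ s → s ℤ.* X a) (trans (ff-+ κ a r) (cong (λ z → ff κ a ℤ.* ff z r) shift)) ⟩
        ff κ a ℤ.* ff (+ k ℤ.- + (2 + a)) r ℤ.* X a
          ≡⟨ ℤ.*-assoc (ff κ a) _ (X a) ⟩
        ff κ a ℤ.* (ff (+ k ℤ.- + (2 + a)) r ℤ.* X a)
          ≡⟨ cong (λ s → ff κ a ℤ.* s) (Σ-ff blocks (ff (+ k ℤ.- + (2 + a)) r) (ff (+ v ℤ.- + (2 + a)) r ℤ.* l) a 2
               (Σ-incl-smaller (2 + a) r (cong (λ s → 2 + s) (ℕ.m+[n∸m]≡n a≤5))) S₂ W ∣S₂∣ disjoint) ⟩
        ff κ a ℤ.* (ff (+ ∣ W ∣) a ℤ.* (ff (+ v ℤ.- + (2 + a)) r ℤ.* l))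
          ≡⟨ cong (λ z → ff κ a ℤ.* (ff z a ℤ.* (ff (+ v ℤ.- + (2 + a)) r ℤ.* l))) ∣W∣ ⟩
        ff κ a ℤ.* (ff (+ k ℤ.- 1ℤ) a ℤ.* (ff (+ v ℤ.- + (2 + a)) r ℤ.* l))
          ≡⟨ regroup (ff κ a) (ff (+ k ℤ.- 1ℤ) a) (ff (+ v ℤ.- + (2 + a)) r) l ⟩
        R a ℤ.* l ∎
        where
        open ≡-Reasoning
        κ = + k ℤ.- + 2
        r = 5 ∸ a
        shift : κ ℤ.- + a ≡ + k ℤ.- + (2 + a)
        shift = trans (join (+ k) (+ a)) (cong (λ s → + k ℤ.- s) (sym (ℤ.pos-+ 2 a)))
          where
          join : ∀ k a → k ℤ.- + 2 ℤ.- a ≡ k ℤ.- (+ 2 ℤ.+ a)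
          join = solve-∀
        regroup : ∀ a b c l → a ℤ.* (b ℤ.* (c ℤ.* l)) ≡ a ℤ.* (b ℤ.* c) ℤ.* l
        regroup = solve-∀

      K*combine : K ℤ.* combine X ≡ combine R ℤ.* l
      K*combine = begin
        K ℤ.* combine X
          ≡⟨ Σ-*ˡ (upTo 5) K (λ a → γ a ℤ.* X a) ⟨
        Σ (upTo 5) (λ a → K ℤ.* (γ a ℤ.* X a))
          ≡⟨ Σ-cong-∈ (upTo 5) (λ a a∈ → trans (regroup K (γ a) (X a))
               (trans (cong (λ s → γ a ℤ.* s) (K*X a (ℕ.<⇒≤ (∈-upTo⁻ a∈)))) (sym (ℤ.*-assoc (γ a) (R a) l)))) ⟩
        Σ (upTo 5) (λ a → γ a ℤ.* R a ℤ.* l)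
          ≡⟨ Σ-*ʳ (upTo 5) l (λ a → γ a ℤ.* R a) ⟩
        combine R ℤ.* l ∎
        where
        open ≡-Reasoning
        regroup : ∀ k c x → k ℤ.* (c ℤ.* x) ≡ c ℤ.* (k ℤ.* x)
        regroup = solve-∀

      combine-X : combine X ≡ Σ blocks (λ B → incl S₂ B ℤ.* combine (ff (+ ∣ B ∩ W ∣)))
      combine-X = begin
        Σ (upTo 5) (λ a → γ a ℤ.* X a)
          ≡⟨ Σ-cong (upTo 5) (λ a → sym (Σ-*ˡ blocks (γ a) (λ B → incl S₂ B ℤ.* ff (+ ∣ B ∩ W ∣) a))) ⟩
        Σ (upTo 5) (λ a → Σ blocks (λ B → γ a ℤ.* (incl S₂ B ℤ.* ff (+ ∣ B ∩ W ∣) a)))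
          ≡⟨ Σ-swap (upTo 5) blocks (λ a B → γ a ℤ.* (incl S₂ B ℤ.* ff (+ ∣ B ∩ W ∣) a)) ⟩
        Σ blocks (λ B → Σ (upTo 5) (λ a → γ a ℤ.* (incl S₂ B ℤ.* ff (+ ∣ B ∩ W ∣) a)))
          ≡⟨ Σ-cong blocks (λ B → trans
               (Σ-cong (upTo 5) (λ a → regroup (γ a) (incl S₂ B) (ff (+ ∣ B ∩ W ∣) a)))
               (Σ-*ˡ (upTo 5) (incl S₂ B) (λ a → γ a ℤ.* ff (+ ∣ B ∩ W ∣) a))) ⟩
        Σ blocks (λ B → incl S₂ B ℤ.* combine (ff (+ ∣ B ∩ W ∣))) ∎
        where
        open ≡-Reasoning
        regroup : ∀ c i f → c ℤ.* (i ℤ.* f) ≡ i ℤ.* (c ℤ.* f)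
        regroup = solve-∀

      384∣combine-X : + 384 ∣ᶻ combine X
      384∣combine-X = subst (+ 384 ∣ᶻ_) (sym combine-X) (Σ-∣ (+ 384) blocks term)
        where
        term : ∀ B → B ∈ blocks → + 384 ∣ᶻ incl S₂ B ℤ.* combine (ff (+ ∣ B ∩ W ∣))
        term B B∈ with lookup B p in Bp
        -- A block through `p` meets `T` in an even number of points, hence `W` in one fewer, an odd
        -- number. Whether it also contains `q` affects only the factor `incl S₂ B`.
        ... | true  = ∣.∣n⇒∣m*n (incl S₂ B) (384-∣-combine ∣ B ∩ W ∣ h
          (trans (sym (meet-remove B T p Bp p∈T)) (proj₂ even)))
          where
          even = meet-even (proj₁ (∈-blocks B∈)) CT
          h = proj₁ even
        ... | false = divides 0ℤ (cong (λ s → s ℤ.* combine (ff (+ ∣ B ∩ W ∣))) absent)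
          where
          absent : incl S₂ B ≡ 0ℤ
          absent = trans (incl-add S₁ B q q∉S₁) (trans
            (cong (λ s → ι (lookup B q) ℤ.* s) (trans (incl-add zeroWord B p p∉zero)
              (cong (λ t → ι t ℤ.* incl zeroWord B) Bp)))
            (ℤ.*-zeroʳ (ι (lookup B q))))

      -- The quotient is `combine X / 384`. The equations for `b`, for λ₇ and for `K * combine X`
      -- are multiplied together, which avoids any division.
      divisibility : divisor m ∣ᶻ dividend m
      divisibility = divides z (begin
        combine R ℤ.* (ff (+ k) 7 ℤ.* N)
          ≡⟨ cong (λ s → combine R ℤ.* (ff (+ k) 7 ℤ.* s)) blockCount ⟨
        combine R ℤ.* (ff (+ k) 7 ℤ.* (b ℤ.* F))
          ≡⟨ regroup₁ (combine R) (ff (+ k) 7) b F ⟩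
        combine R ℤ.* (b ℤ.* ff (+ k) 7) ℤ.* F
          ≡⟨ cong (λ s → combine R ℤ.* s ℤ.* F) b-λ₇ ⟩
        combine R ℤ.* (ff (+ v) 7 ℤ.* l) ℤ.* F
          ≡⟨ regroup₂ (combine R) (ff (+ v) 7) l F ⟩
        combine R ℤ.* l ℤ.* (ff (+ v) 7 ℤ.* F)
          ≡⟨ cong (λ s → s ℤ.* (ff (+ v) 7 ℤ.* F)) (trans (sym K*combine) (cong (λ s → K ℤ.* s) (_∣ᶻ_.equality 384∣combine-X))) ⟩
        K ℤ.* (z ℤ.* + 384) ℤ.* (ff (+ v) 7 ℤ.* F)
          ≡⟨ regroup₃ K z (ff (+ v) 7) F ⟩
        z ℤ.* (+ 384 ℤ.* K ℤ.* (ff (+ v) 7 ℤ.* F)) ∎)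
        where
        open ≡-Reasoning
        z = ∣.quotient 384∣combine-X
        F = Π (otherWeights m) (+ k) ℤ.* + (2 ^ length (otherWeights m))
        N = mean (fromRoots (otherWeights m)) (+ v) (length (otherWeights m)) ℤ.* + (2 ^ (12 * m))
        regroup₁ : ∀ r f b g → r ℤ.* (f ℤ.* (b ℤ.* g)) ≡ r ℤ.* (b ℤ.* f) ℤ.* g
        regroup₁ = solve-∀
        regroup₂ : ∀ r f l g → r ℤ.* (f ℤ.* l) ℤ.* g ≡ r ℤ.* l ℤ.* (f ℤ.* g)
        regroup₂ = solve-∀
        regroup₃ : ∀ k z f g → k ℤ.* (z ℤ.* + 384) ℤ.* (f ℤ.* g) ≡ z ℤ.* (+ 384 ℤ.* k ℤ.* (f ℤ.* g))
        regroup₃ = solve-∀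

    divisor∣dividend : divisor m ∣ᶻ dividend m
    divisor∣dividend = TwoPoints.divisibility T CT wtT (proj₁ p∈) (proj₁ q∉) (proj₂ p∈) (proj₂ q∉)
      where
      -- The block `T` is the word attaining the minimum weight; `p` exists because its weight is
      -- positive, and `q` because `4m + 4 ≤ 8m < 24m`.
      witness = proj₂ (proj₂ (proj₂ (proj₂ (proj₂ ext))))
      T = proj₁ witness
      CT = proj₁ (proj₂ witness)
      wtT = proj₂ (proj₂ (proj₂ witness))
      p∈ : ∃ λ p → lookup T p ≡ true
      p∈ = ∃-inside T (subst (0 <_) (sym wtT) (ℕ.≤-trans (s≤s z≤n) (ℕ.m≤n+m 4 (4 * m))))
      q∉ : ∃ λ q → lookup T q ≡ false
      q∉ = ∃-outside T (subst (_< v) (sym wtT) (begin-strict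
        4 * m + 4        ≤⟨ ℕ.+-monoʳ-≤ (4 * m) (ℕ.*-monoʳ-≤ 4 1≤m) ⟩
        4 * m + 4 * m    ≡⟨ ℕ.*-distribʳ-+ m 4 4 ⟨
        8 * m            <⟨ ℕ.*-monoˡ-< m ⦃ ℕ.>-nonZero 1≤m ⦄ {8} {24} (ℕ.m≤m+n 9 15) ⟩
        24 * m           ∎))
        where open ℕ.≤-Reasoning

-- Reduction to a numerical non-divisibility, and the nine values of `m`.

not-7-design : (m : ℕ) → 1 ≤ m → ¬ divisor m ∣ᶻ dividend m →
  (C : Code (24 * m)) (C? : Decidable C) → IsExtremalDESD m C C? →
  ¬ IsTDesign 7 (supportDesign C C? (4 * m + 4))
not-7-design m 1≤m ndiv C C? ext (_ , λ₇ , count) =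
  ndiv (Extremal.SevenDesign.divisor∣dividend m 1≤m C C? ext λ₇ count)
theorem5 : (m : ℕ) → m ∈ (5 ∷ 19 ∷ 35 ∷ 41 ∷ 51 ∷ 65 ∷ 75 ∷ 101 ∷ 129 ∷ []) →
    (C : Code (24 * m)) (C? : Decidable C) → IsExtremalDESD m C C? →
    ¬ IsTDesign 7 (supportDesign C C? (4 * m + 4))
-- For a numeral `m` both integers are closed terms, so the decision procedure for divisibility
-- evaluates to a refutation.
theorem5 m (here refl) = not-7-design 5 (s≤s z≤n) (from-no (divisor 5 ∣.∣? dividend 5))
theorem5 m (there (here refl)) = not-7-design 19 (s≤s z≤n) (from-no (divisor 19 ∣.∣? dividend 19))
theorem5 m (there (there (here refl))) = not-7-design 35 (s≤s z≤n) (from-no (divisor 35 ∣.∣? dividend 35))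
theorem5 m (there (there (there (here refl)))) = not-7-design 41 (s≤s z≤n) (from-no (divisor 41 ∣.∣? dividend 41))
theorem5 m (there (there (there (there (here refl))))) =
  not-7-design 51 (s≤s z≤n) (from-no (divisor 51 ∣.∣? dividend 51))
theorem5 m (there (there (there (there (there (here refl)))))) =
  not-7-design 65 (s≤s z≤n) (from-no (divisor 65 ∣.∣? dividend 65))
theorem5 m (there (there (there (there (there (there (here refl))))))) =
  not-7-design 75 (s≤s z≤n) (from-no (divisor 75 ∣.∣? dividend 75))
theorem5 m (there (there (there (there (there (there (there (here refl)))))))) =
  not-7-design 101 (s≤s z≤n) (from-no (divisor 101 ∣.∣? dividend 101))
theorem5 m (there (there (there (there (there (there (there (there (here refl))))))))) =
  not-7-design 129 (s≤s z≤n) (from-no (divisor 129 ∣.∣? dividend 129))
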